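{- Let $\mathcal C$ be a cartesian $R$-differential category, where $R$ has multiplicative inverses for integers, and let $n,m\in\mathbb N\cup\{\omega\}$ (the value $\omega$ being allowed provided countable powers exist in $\mathcal C$). Then $(T_n,\iota_n,\theta_n)$ is a monad on $\mathcal C$, and $c_{n,m}:T_nT_m\Rightarrow T_mT_n$ is a distributive law of the monad $T_n$ over the monad $T_m$.
   Context: $R$ is a commutative semiring with multiplicative inverses for integers: for each integer $n\ge1$ there is $\frac1n\in R$ with $\frac1n\cdot(1_R+\cdots+1_R)=1_R$ ($n$ summands). A map between $R$-semimodules is $R$-additive if it preserves sums, $0$ and the action of $R$. A left $R$-additive category is a category $\mathcal C$ whose hom-sets are $R$-semimodules and such that every precomposition map $\_\circ f$ is $R$-additive; a morphism $h:Y\to Z$ is $R$-additive if every postcomposition map $h\circ\_:\mathcal C(X,Y)\to\mathcal C(X,Z)$ is $R$-additive. A cartesian left $R$-additive category is one with finite products whose projections are $R$-additive. $\langle\cdots\rangle$ denotes tupling. Put $SX=X\times X$ with projections $\pi_0,\pi_1:SX\to X$. A derivative is a family of operators $D:\mathcal C(X,Y)\to\mathcal C(SX,Y)$ such that: (i) $Dp=p\circ\pi_1$ for every product projection $p:X_0\times\cdots\times X_n\to X_i$; (ii) $D$ is $R$-additive; (iii) $D\,\mathrm{id}=\pi_1$ and $D(g\circ f)=Dg\circ\langle f\circ\pi_0,Df\rangle$; (iv) $Df$ is $R$-additive in its second argument, i.e. $u\mapsto Df\circ\langle x,u\rangle$ is $R$-additive; (v) $DDf\circ\langle\langle x,0\rangle,\langle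 0,u\rangle\rangle=Df\circ\langle x,u\rangle$; (vi) $DDf\circ\langle\langle x,u\rangle,\langle v,w\rangle\rangle=DDf\circ\langle\langle x,v\rangle,\langle u,w\rangle\rangle$. A cartesian $R$-differential category is a cartesian left $R$-additive category with a derivative. For $n\in\mathbb N$, $S_nX=X^{n+1}$ with projections $\pi_0,\dots,\pi_n$; when countable powers exist, $S_\omega X=\prod_{i=0}^\infty X$ with projections $\pi_i$ ($i\in\mathbb N$), which are then assumed $R$-additive and to satisfy $D\pi_i=\pi_i\circ\pi_1$. For $m\le n$ with $m\in\mathbb N$, $s_{n\to m}=\langle\pi_0,\dots,\pi_m\rangle:S_nX\to S_mX$. For $1\le n<\omega$, $\nu_n=\langle\langle\pi_0,\dots,\pi_{n-1}\rangle,\langle\tfrac1n\pi_1,\tfrac2n\pi_2,\dots,\tfrac nn\pi_n\rangle\rangle:S_nX\to SS_{n-1}X$. For $f\in\mathcal C(X,Y)$ define $t_nf:S_nX\to Y$ ($n\in\mathbb N$) by $t_0f=f$, $t_{n+1}f=D(t_nf)\circ\nu_{n+1}$. For $n\in\mathbb N\cup\{\omega\}$ the functor $T_n$ on $\mathcal C$ is $T_nX=S_nX$ and, for $f:X\to Y$, $\pi_i\circ T_nf=t_if\circ s_{n\to i}$ for all finite $i\le n$. The families $\iota_n:X\to S_nX$, $\theta_n:S_nS_nX\to S_nX$, $c_{n,m}:S_nS_mX\to S_mS_nX$ are characterized by (all indices finite): $\pi_k\circ\iota_n=\mathrm{id}$ if $k=0$ and $0$ otherwise; $\pi_k\circ\theta_n=\sum_{i+j=k}\pi_i\circ\pi_j$;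 $\pi_i\circ\pi_j\circ c_{n,m}=\pi_j\circ\pi_i$ for $i\le n$, $j\le m$. (In a composite of projections the right-most one projects the outermost functor.) A distributive law is meant in the sense of Beck. -}

module Defs where

open import Level using (Level; _⊔_; suc)
open import Algebra.Bundles using (CommutativeSemiring)
open import Algebra.Module.Bundles using (LeftSemimodule)
open import Algebra.Module.Morphism.Structures using (module LeftSemimoduleMorphisms)
open import Algebra.Module.Structures using (IsLeftSemimodule)
import Algebra.Definitions.RawMonoid as RawMonoidDefinitions
open import Data.Fin.Base using (Fin; toℕ; inject₁; inject≤; opposite) renaming (zero to fzero; suc to fsuc)
open import Data.Fin.Properties using (toℕ<n)
open import Data.Maybe using (Maybe; Is-just; to-witness)
open import Data.Nat.Base using (ℕ; NonZero) renaming (zero to nzero; suc to nsuc)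
open import Data.Vec.Functional using ([]; _∷_)
open import Relation.Binary.Structures using (IsEquivalence)

private
  variable
    r ℓr o ℓ e : Level

record PositiveIntegerInverses (R : CommutativeSemiring r ℓr) : Set (r ⊔ ℓr) where
  open CommutativeSemiring R
  open RawMonoidDefinitions +-rawMonoid using (_×_)

  infix 8 1/_
  infixl 7 _/_

  field
    1/_     : (n : ℕ) → .{{NonZero n}} → Carrier
    inverse : (n : ℕ) → .{{_ : NonZero n}} → (1/ n) * (n × 1#) ≈ 1#

  _/_ : ℕ → (n : ℕ) → .{{NonZero n}} → Carrier
  k / n = (k × 1#) * (1/ n)

record Category (o ℓ e : Level) : Set (suc (o ⊔ ℓ ⊔ e)) where
  infix  4 _≈_ _⇒_
  infixr 9 _∘_

  field
    Obj : Set o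
    _⇒_ : Obj → Obj → Set ℓ
    _≈_ : {X Y : Obj} → X ⇒ Y → X ⇒ Y → Set e
    id  : {X : Obj} → X ⇒ X
    _∘_ : {X Y Z : Obj} → Y ⇒ Z → X ⇒ Y → X ⇒ Z

    isEquivalence : {X Y : Obj} → IsEquivalence (_≈_ {X} {Y})
    ∘-resp-≈      : {X Y Z : Obj} {g g′ : Y ⇒ Z} {f f′ : X ⇒ Y} →
                    g ≈ g′ → f ≈ f′ → g ∘ f ≈ g′ ∘ f′
    identityˡ     : {X Y : Obj} {f : X ⇒ Y} → id ∘ f ≈ f
    identityʳ     : {X Y : Obj} {f : X ⇒ Y} → f ∘ id ≈ f
    assoc         : {W X Y Z : Obj} {f : W ⇒ X} {g : X ⇒ Y} {h : Y ⇒ Z} →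
                    (h ∘ g) ∘ f ≈ h ∘ (g ∘ f)

record RawMonad (C : Category o ℓ e) : Set (o ⊔ ℓ) where
  open Category C
  field
    F₀ : Obj → Obj
    F₁ : {X Y : Obj} → X ⇒ Y → F₀ X ⇒ F₀ Y
    η  : (X : Obj) → X ⇒ F₀ X
    μ  : (X : Obj) → F₀ (F₀ X) ⇒ F₀ X

module _ (C : Category o ℓ e) where
  open Category C

  record IsEndofunctor (F₀ : Obj → Obj)
                       (F₁ : {X Y : Obj} → X ⇒ Y → F₀ X ⇒ F₀ Y) : Set (o ⊔ ℓ ⊔ e) where
    field
      F-resp-≈     : {X Y : Obj} {f g : X ⇒ Y} → f ≈ g → F₁ f ≈ F₁ g
      identity     : {X : Obj} → F₁ (id {X}) ≈ id
      homomorphism : {X Y Z : Obj} {f : X ⇒ Y} {g : Y ⇒ Z} → F₁ (g ∘ f) ≈ F₁ g ∘ F₁ f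

  record IsMonad (T : RawMonad C) : Set (o ⊔ ℓ ⊔ e) where
    open RawMonad T
    field
      isEndofunctor : IsEndofunctor F₀ F₁
      η-natural     : {X Y : Obj} (f : X ⇒ Y) → η Y ∘ f ≈ F₁ f ∘ η X
      μ-natural     : {X Y : Obj} (f : X ⇒ Y) → μ Y ∘ F₁ (F₁ f) ≈ F₁ f ∘ μ X
      μ-assoc       : (X : Obj) → μ X ∘ F₁ (μ X) ≈ μ X ∘ μ (F₀ X)
      μ-identityˡ   : (X : Obj) → μ X ∘ F₁ (η X) ≈ id
      μ-identityʳ   : (X : Obj) → μ X ∘ η (F₀ X) ≈ id

  -- κ : S T ⇒ T S is a distributive law of S over T in the sense of Beck.
  record IsDistributiveLaw (S T : RawMonad C)
           (κ : (X : Obj) → RawMonad.F₀ S (RawMonad.F₀ T X) ⇒ RawMonad.F₀ T (RawMonad.F₀ S X))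
         : Set (o ⊔ ℓ ⊔ e) where
    private
      module S = RawMonad S
      module T = RawMonad T
    field
      natural : {X Y : Obj} (f : X ⇒ Y) →
                κ Y ∘ S.F₁ (T.F₁ f) ≈ T.F₁ (S.F₁ f) ∘ κ X
      unitˢ   : (X : Obj) → κ X ∘ S.η (T.F₀ X) ≈ T.F₁ (S.η X)
      unitᵗ   : (X : Obj) → κ X ∘ S.F₁ (T.η X) ≈ T.η (S.F₀ X)
      multˢ   : (X : Obj) → κ X ∘ S.μ (T.F₀ X) ≈ T.F₁ (S.μ X) ∘ (κ (S.F₀ X) ∘ S.F₁ (κ X))
      multᵗ   : (X : Obj) → κ X ∘ S.F₁ (T.μ X) ≈ T.μ (S.F₀ X) ∘ (T.F₁ (κ X) ∘ κ (T.F₀ X))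

record Product (C : Category o ℓ e) {I : Set} (A : I → Category.Obj C) : Set (o ⊔ ℓ ⊔ e) where
  open Category C
  field
    object  : Obj
    π       : (i : I) → object ⇒ A i
    tuple   : {Z : Obj} → ((i : I) → Z ⇒ A i) → Z ⇒ object
    project : {Z : Obj} (f : (i : I) → Z ⇒ A i) (i : I) → π i ∘ tuple f ≈ f i
    unique  : {Z : Obj} (f : (i : I) → Z ⇒ A i) (h : Z ⇒ object) →
              ((i : I) → π i ∘ h ≈ f i) → h ≈ tuple f

record LeftAdditiveCategory (R : CommutativeSemiring r ℓr) (o ℓ e : Level)
       : Set (r ⊔ ℓr ⊔ suc (o ⊔ ℓ ⊔ e)) where
  open CommutativeSemiring R using (semiring) renaming (Carrier to Scalar)

  field
    category : Category o ℓ e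

  open Category category public

  infixl 6 _+ᴹ_
  infixr 7 _*ₗ_

  -- Since R is commutative, a left R-semimodule is the same as an R-semimodule.
  field
    _+ᴹ_ : {X Y : Obj} → X ⇒ Y → X ⇒ Y → X ⇒ Y
    0ᴹ   : {X Y : Obj} → X ⇒ Y
    _*ₗ_ : {X Y : Obj} → Scalar → X ⇒ Y → X ⇒ Y
    isLeftSemimodule : {X Y : Obj} →
                       IsLeftSemimodule semiring (_≈_ {X} {Y}) _+ᴹ_ 0ᴹ _*ₗ_

  hom : Obj → Obj → LeftSemimodule semiring ℓ e
  hom X Y = record { isLeftSemimodule = isLeftSemimodule {X} {Y} }

  IsAdditiveMap : {X Y X′ Y′ : Obj} → (X ⇒ Y → X′ ⇒ Y′) → Set (r ⊔ ℓ ⊔ e)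
  IsAdditiveMap {X} {Y} {X′} {Y′} =
    LeftSemimoduleMorphisms.IsLeftSemimoduleHomomorphism
      (LeftSemimodule.rawLeftSemimodule (hom X Y))
      (LeftSemimodule.rawLeftSemimodule (hom X′ Y′))

  field
    precomposition-additive : {X Y Z : Obj} (f : X ⇒ Y) →
                              IsAdditiveMap (λ (g : Y ⇒ Z) → g ∘ f)

  IsAdditive : {Y Z : Obj} → Y ⇒ Z → Set (r ⊔ o ⊔ ℓ ⊔ e)
  IsAdditive {Y} h = {X : Obj} → IsAdditiveMap (λ (f : X ⇒ Y) → h ∘ f)

  sum : {X Y : Obj} {n : ℕ} → (Fin n → X ⇒ Y) → X ⇒ Y
  sum {X} {Y} = RawMonoidDefinitions.sum (LeftSemimodule.+ᴹ-rawMonoid (hom X Y))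

record CartesianLeftAdditiveCategory (R : CommutativeSemiring r ℓr) (o ℓ e : Level)
       : Set (r ⊔ ℓr ⊔ suc (o ⊔ ℓ ⊔ e)) where
  field
    leftAdditiveCategory : LeftAdditiveCategory R o ℓ e

  open LeftAdditiveCategory leftAdditiveCategory public

  field
    product    : {n : ℕ} (A : Fin n → Obj) → Product category A
    π-additive : {n : ℕ} (A : Fin n → Obj) (i : Fin n) →
                 IsAdditive (Product.π (product A) i)

  finitePower : (n : ℕ) (X : Obj) → Product category (λ (_ : Fin (nsuc n)) → X)
  finitePower n X = product (λ _ → X)

  Sₙ : ℕ → Obj → Obj
  Sₙ n X = Product.object (finitePower n X)

  S : Obj → Obj
  S = Sₙ 1

  π₀ π₁ : {X : Obj} → S X ⇒ X
  π₀ {X} = Product.π (finitePower 1 X) fzero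
  π₁ {X} = Product.π (finitePower 1 X) (fsuc fzero)

  ⟨_,_⟩ : {Z X : Obj} → Z ⇒ X → Z ⇒ X → Z ⇒ S X
  ⟨_,_⟩ {Z} {X} f g = Product.tuple (finitePower 1 X) (f ∷ g ∷ [])

record CartesianDifferentialCategory (R : CommutativeSemiring r ℓr) (o ℓ e : Level)
       : Set (r ⊔ ℓr ⊔ suc (o ⊔ ℓ ⊔ e)) where
  field
    cartesianLeftAdditiveCategory : CartesianLeftAdditiveCategory R o ℓ e

  open CartesianLeftAdditiveCategory cartesianLeftAdditiveCategory public

  field
    D : {X Y : Obj} → X ⇒ Y → S X ⇒ Y
    D-π          : {n : ℕ} (A : Fin n → Obj) (i : Fin n) →
                   D (Product.π (product A) i) ≈ Product.π (product A) i ∘ π₁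
    D-additive   : {X Y : Obj} → IsAdditiveMap (D {X} {Y})
    D-id         : {X : Obj} → D (id {X}) ≈ π₁
    D-∘          : {X Y Z : Obj} (f : X ⇒ Y) (g : Y ⇒ Z) →
                   D (g ∘ f) ≈ D g ∘ ⟨ f ∘ π₀ , D f ⟩
    D-additive₂  : {X Y Z : Obj} (f : X ⇒ Y) (x : Z ⇒ X) →
                   IsAdditiveMap (λ (u : Z ⇒ X) → D f ∘ ⟨ x , u ⟩)
    D-linear     : {X Y Z : Obj} (f : X ⇒ Y) (x u : Z ⇒ X) →
                   D (D f) ∘ ⟨ ⟨ x , 0ᴹ ⟩ , ⟨ 0ᴹ , u ⟩ ⟩ ≈ D f ∘ ⟨ x , u ⟩
    D-symmetric  : {X Y Z : Obj} (f : X ⇒ Y) (x u v w : Z ⇒ X) →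
                   D (D f) ∘ ⟨ ⟨ x , u ⟩ , ⟨ v , w ⟩ ⟩ ≈
                   D (D f) ∘ ⟨ ⟨ x , v ⟩ , ⟨ u , w ⟩ ⟩

record CountablePowers {R : CommutativeSemiring r ℓr} (C : CartesianDifferentialCategory R o ℓ e)
       : Set (r ⊔ o ⊔ ℓ ⊔ e) where
  open CartesianDifferentialCategory C
  field
    power       : (X : Obj) → Product category (λ (_ : ℕ) → X)
    πω-additive : (X : Obj) (i : ℕ) → IsAdditive (Product.π (power X) i)
    D-πω        : (X : Obj) (i : ℕ) →
                  D (Product.π (power X) i) ≈ Product.π (power X) i ∘ π₁

-- The elements of ℕ ∪ {ω}, where ω is available only if countable powers are given.
data Order {a} {A : Set a} (P : Maybe A) : Set a where
  fin : ℕ → Order P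
  ω   : Is-just P → Order P

-- The finite i with i ≤ n.
Index : ∀ {a} {A : Set a} {P : Maybe A} → Order P → Set
Index (fin n) = Fin (nsuc n)
Index (ω _)   = ℕ

value : ∀ {a} {A : Set a} {P : Maybe A} (n : Order P) → Index n → ℕ
value (fin n) i = toℕ i
value (ω _)   i = i

-- The inclusion {0,…,k} ⊆ {i finite | i ≤ n} for k ≤ n.
include : ∀ {a} {A : Set a} {P : Maybe A} (n : Order P) (k : Index n) →
          Fin (nsuc (value n k)) → Index n
include (fin n) k i = inject≤ i (toℕ<n k)
include (ω _)   k i = toℕ i

module Taylor {R : CommutativeSemiring r ℓr} (inverses : PositiveIntegerInverses R)
              (C : CartesianDifferentialCategory R o ℓ e)
              (P : Maybe (CountablePowers C)) where
  open PositiveIntegerInverses inverses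
  open CartesianDifferentialCategory C

  ν : (n : ℕ) (X : Obj) → Sₙ (nsuc n) X ⇒ S (Sₙ n X)
  ν n X = ⟨ tuple (λ i → π (inject₁ i))
          , tuple (λ i → (nsuc (toℕ i) / nsuc n) *ₗ π (fsuc i)) ⟩
    where
    open Product (finitePower n X) using (tuple)
    open Product (finitePower (nsuc n) X) using (π)

  -- In the base case, π identifies the unary power Sₙ 0 X with X.
  t : (n : ℕ) {X Y : Obj} → X ⇒ Y → Sₙ n X ⇒ Y
  t nzero    {X} f = f ∘ Product.π (finitePower 0 X) fzero
  t (nsuc n) {X} f = D (t n f) ∘ ν n X

  power : (n : Order P) (X : Obj) → Product category (λ (_ : Index n) → X)
  power (fin n) X = finitePower n X
  power (ω p)   X = CountablePowers.power (to-witness p) X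

  module Power (n : Order P) (X : Obj) = Product (power n X)

  T₀ : Order P → Obj → Obj
  T₀ n X = Power.object n X

  restrict : (n : Order P) (m : Index n) (X : Obj) → T₀ n X ⇒ Sₙ (value n m) X
  restrict n m X = Product.tuple (finitePower (value n m) X) (λ i → Power.π n X (include n m i))

  T₁ : (n : Order P) {X Y : Obj} → X ⇒ Y → T₀ n X ⇒ T₀ n Y
  T₁ n {X} {Y} f = Power.tuple n Y (λ i → t (value n i) f ∘ restrict n i X)

  δ : ℕ → (X : Obj) → X ⇒ X
  δ nzero    X = id
  δ (nsuc _) X = 0ᴹ

  ι : (n : Order P) (X : Obj) → X ⇒ T₀ n X
  ι n X = Power.tuple n X (λ k → δ (value n k) X)

  -- For i ∈ {0,…,k}, opposite i is k - i.
  θ : (n : Order P) (X : Obj) → T₀ n (T₀ n X) ⇒ T₀ n X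
  θ n X = Power.tuple n X λ k →
    sum λ (i : Fin (nsuc (value n k))) →
      Power.π n X (include n k i) ∘ Power.π n (T₀ n X) (include n k (opposite i))

  c : (n m : Order P) (X : Obj) → T₀ n (T₀ m X) ⇒ T₀ m (T₀ n X)
  c n m X = Power.tuple m (T₀ n X) λ j → Power.tuple n X λ i →
    Power.π m X j ∘ Power.π n (T₀ m X) i

  T : Order P → RawMonad category
  T n = record { F₀ = T₀ n ; F₁ = T₁ n ; η = ι n ; μ = θ n }

module Submission where

-- Call a sequence x₀, x₁, … of morphisms out of Z a Taylor sequence for a vector field v : Z ⇒ Z
-- if the derivative of xₖ along v is (k + 1) xₖ₊₁. Since integers are invertible, such a sequence
-- is determined by x₀; and every f sends it to the Taylor sequence k ↦ tₖ f ∘ ⟨x₀, …, xₖ⟩.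
-- The projections of T n X form a Taylor sequence for the shift xₖ ↦ (k + 1) xₖ₊₁, so functoriality
-- and naturality of ι reduce to comparing zeroth terms. On T n (T m X) the outer and the inner
-- shift have commuting derivatives, hence the double Taylor coefficients form a Taylor sequence in
-- either index, which gives naturality of c; and antidiagonal sums of them form a Taylor
-- sequence for the sum of both shifts, which gives naturality of θ. The remaining laws involve
-- only linear maps h, for which T n h acts componentwise.

open import Defs
open import Level using (_⊔_)
open import Algebra.Bundles using (CommutativeMonoid; CommutativeSemiring)
import Algebra.Definitions.RawMonoid as RawMonoidDefinitions
open import Algebra.Module.Bundles using (LeftSemimodule)
open import Algebra.Module.Morphism.Structures using (module LeftSemimoduleMorphisms)
import Algebra.Properties.CommutativeMonoid.Mult as CommutativeMonoidMult
import Algebra.Properties.CommutativeSemigroup as CommutativeSemigroupProperties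
open import Data.Fin.Base using (Fin; toℕ; fromℕ<; inject₁; opposite) renaming (zero to fzero; suc to fsuc)
open import Data.Fin.Properties using (toℕ<n; toℕ-inject₁; toℕ-inject≤; toℕ-fromℕ; toℕ-fromℕ<)
open import Data.Maybe using (Maybe; to-witness)
open import Data.Nat.Base as ℕ using (ℕ; zero; suc; s≤s)
import Data.Nat.Properties as ℕ
open import Data.Product using (_×_; _,_; ∃)
open import Data.Sum.Base using (_⊎_; inj₁; inj₂)
open import Relation.Binary.PropositionalEquality as ≡ using (_≡_)
import Relation.Binary.Reasoning.Setoid as SetoidReasoning
open import Relation.Binary.Structures using (IsEquivalence)
open import Relation.Nullary using (yes; no)

-- Antidiagonal sums in a commutative monoid.

module AntidiagonalSum {a ℓ} (M : CommutativeMonoid a ℓ) where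
  open CommutativeMonoid M renaming (_∙_ to _+_; ε to 0#)
  open RawMonoidDefinitions rawMonoid using (sum)
  open CommutativeMonoidMult M renaming (_×_ to _·_)
  open CommutativeSemigroupProperties commutativeSemigroup using (interchange)
  open SetoidReasoning setoid

  -- ∑ k G is the sum of G i j over all i + j = k.
  ∑ : ℕ → (ℕ → ℕ → Carrier) → Carrier
  ∑ zero    G = G 0 0
  ∑ (suc k) G = G 0 (suc k) + ∑ k (λ i j → G (suc i) j)

  ∑-cong : ∀ k {F G} → (∀ i j → i ℕ.+ j ≡ k → F i j ≈ G i j) → ∑ k F ≈ ∑ k G
  ∑-cong zero    F≈G = F≈G 0 0 ≡.refl
  ∑-cong (suc k) F≈G =
    ∙-cong (F≈G 0 (suc k) ≡.refl)
           (∑-cong k (λ i j i+j≡k → F≈G (suc i) j (≡.cong suc i+j≡k)))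

  ∑-+ : ∀ k F G → ∑ k (λ i j → F i j + G i j) ≈ ∑ k F + ∑ k G
  ∑-+ zero    F G = refl
  ∑-+ (suc k) F G = trans (∙-congˡ (∑-+ k _ _)) (interchange _ _ _ _)

  ∑-zero : ∀ k → ∑ k (λ _ _ → 0#) ≈ 0#
  ∑-zero zero    = refl
  ∑-zero (suc k) = trans (identityˡ _) (∑-zero k)

  ∑-· : ∀ k n G → ∑ k (λ i j → n · G i j) ≈ n · ∑ k G
  ∑-· zero    n G = refl
  ∑-· (suc k) n G = trans (∙-congˡ (∑-· k n _)) (sym (×-distrib-+ _ _ n))

  -- The recursion of `∑` strips the end where the first index is 0; reindexing in the second index
  -- needs the opposite end.
  ∑-last : ∀ k G → ∑ (suc k) G ≈ ∑ k (λ i j → G i (suc j)) + G (suc k) 0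
  ∑-last zero    G = refl
  ∑-last (suc k) G = trans (∙-congˡ (∑-last k (λ i j → G (suc i) j))) (sym (assoc _ _ _))

  ∑-only-first : ∀ k G → (∀ i j → G (suc i) j ≈ 0#) → ∑ k G ≈ G 0 k
  ∑-only-first zero    G G≈0 = refl
  ∑-only-first (suc k) G G≈0 =
    trans (∙-congˡ (trans (∑-cong k (λ i j _ → G≈0 i j)) (∑-zero k))) (identityʳ _)

  ∑-only-last : ∀ k G → (∀ i j → G i (suc j) ≈ 0#) → ∑ k G ≈ G k 0
  ∑-only-last zero    G G≈0 = refl
  ∑-only-last (suc k) G G≈0 =
    trans (∑-last k G)
      (trans (∙-congʳ (trans (∑-cong k (λ i j _ → G≈0 i j)) (∑-zero k))) (identityˡ _))

  -- Both sides range over triples of indices with the same total. The terms with first index 0 make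
  -- up `∑ (suc k) (F 0)`, and the rest is the induction hypothesis for `F` shifted in that index.
  ∑-assoc : ∀ k (F : ℕ → ℕ → ℕ → Carrier) →
            ∑ k (λ i j → ∑ i (λ a b → F a b j)) ≈ ∑ k (λ a j → ∑ j (F a))
  ∑-assoc zero    F = refl
  ∑-assoc (suc k) F = begin
    F 0 0 (suc k) + ∑ k (λ i j → F 0 (suc i) j + ∑ i (λ a b → F (suc a) b j))
      ≈⟨ ∙-congˡ (∑-+ k _ _) ⟩
    F 0 0 (suc k) + (∑ k (λ i j → F 0 (suc i) j) + ∑ k (λ i j → ∑ i (λ a b → F (suc a) b j)))
      ≈⟨ assoc _ _ _ ⟨
    ∑ (suc k) (F 0) + ∑ k (λ i j → ∑ i (λ a b → F (suc a) b j))
      ≈⟨ ∙-congˡ (∑-assoc k (λ a → F (suc a))) ⟩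
    ∑ (suc k) (F 0) + ∑ k (λ a j → ∑ j (F (suc a)))
      ∎

  -- After reindexing, the two halves weight the term `G i j` of the next antidiagonal by `i` and by
  -- `j`, and there `i + j` is constantly `suc k`.
  ∑-leibniz : ∀ k G → ∑ k (λ i j → suc i · G (suc i) j + suc j · G i (suc j)) ≈
                      suc k · ∑ (suc k) G
  ∑-leibniz k G = begin
    ∑ k (λ i j → suc i · G (suc i) j + suc j · G i (suc j))
      ≈⟨ ∑-+ k _ _ ⟩
    ∑ k (λ i j → suc i · G (suc i) j) + ∑ k (λ i j → suc j · G i (suc j))
      -- The terms added at the two ends have coefficient 0 and reduce to `0#`, so each sum extends
      -- to the whole antidiagonal.
      ≈⟨ ∙-cong (identityˡ _) (identityʳ _) ⟨
    ∑ (suc k) (λ i j → i · G i j) + (∑ k (λ i j → suc j · G i (suc j)) + 0#)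
      ≈⟨ ∙-congˡ (∑-last k (λ i j → j · G i j)) ⟨
    ∑ (suc k) (λ i j → i · G i j) + ∑ (suc k) (λ i j → j · G i j)
      ≈⟨ ∑-+ (suc k) (λ i j → i · G i j) (λ i j → j · G i j) ⟨
    ∑ (suc k) (λ i j → i · G i j + j · G i j)
      ≈⟨ ∑-cong (suc k) (λ i j i+j≡k → trans (sym (×-homo-+ (G i j) i j)) (×-congˡ i+j≡k)) ⟩
    ∑ (suc k) (λ i j → suc k · G i j)
      ≈⟨ ∑-· (suc k) (suc k) G ⟩
    suc k · ∑ (suc k) G
      ∎

  sum-cong : ∀ n {f g : Fin n → Carrier} → (∀ i → f i ≈ g i) → sum f ≈ sum g
  sum-cong zero    f≈g = refl
  sum-cong (suc n) f≈g = ∙-cong (f≈g fzero) (sum-cong n (λ i → f≈g (fsuc i)))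

  -- Links the sums in `θ` to `∑`: since `opposite` sends `fzero` to the top element and `fsuc i` to
  -- `inject₁ (opposite i)`, the two recursions run in step.
  sum≈∑ : ∀ k G → sum (λ (i : Fin (suc k)) → G (toℕ i) (toℕ (opposite i))) ≈ ∑ k G
  sum≈∑ zero    G = identityʳ _
  sum≈∑ (suc k) G = ∙-cong
    (reflexive (≡.cong (G 0) (toℕ-fromℕ (suc k))))
    (trans (sum-cong (suc k) (λ i → reflexive (≡.cong (G (suc (toℕ i))) (toℕ-inject₁ (opposite i)))))
           (sum≈∑ k (λ i j → G (suc i) j)))

-- Padded finite families and the indices of an order.

extend : ∀ {a} {A : Set a} {n} → (Fin n → A) → A → ℕ → A
extend {n = zero}  f z k       = z
extend {n = suc n} f z zero    = f fzero
extend {n = suc n} f z (suc k) = extend (λ i → f (fsuc i)) z k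

extend-toℕ : ∀ {a} {A : Set a} {n} (f : Fin n → A) z i → extend f z (toℕ i) ≡ f i
extend-toℕ f z fzero    = ≡.refl
extend-toℕ f z (fsuc i) = extend-toℕ (λ i → f (fsuc i)) z i

extend-≥ : ∀ {a} {A : Set a} {n} (f : Fin n → A) z {k} → n ℕ.≤ k → extend f z k ≡ z
extend-≥ {n = zero}  f z n≤k       = ≡.refl
extend-≥ {n = suc n} f z (s≤s n≤k) = extend-≥ (λ i → f (fsuc i)) z n≤k

value-include : ∀ {a} {A : Set a} {P : Maybe A} (n : Order P) k i →
                value n (include n k i) ≡ toℕ i
value-include (fin n) k i = toℕ-inject≤ i (toℕ<n k)
value-include (ω _)   k i = ≡.refl

module _ {r ℓr o ℓ e} {R : CommutativeSemiring r ℓr} (inverses : PositiveIntegerInverses R)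
         (C : CartesianDifferentialCategory R o ℓ e) (P : Maybe (CountablePowers C)) where

  open CartesianDifferentialCategory C
  open Taylor inverses C P
  open PositiveIntegerInverses inverses
  private
    module R = CommutativeSemiring R
    module Additive {X Y X′ Y′ : Obj} {F : X ⇒ Y → X′ ⇒ Y′} (F-additive : IsAdditiveMap F) =
      LeftSemimoduleMorphisms.IsLeftSemimoduleHomomorphism F-additive
  open module Hom {X Y : Obj} = LeftSemimodule (hom X Y)
    using (+ᴹ-cong; +ᴹ-congˡ; +ᴹ-identityˡ; *ₗ-congʳ; *ₗ-congˡ; *ₗ-assoc; *ₗ-identityˡ;
           *ₗ-distribʳ; *ₗ-zeroˡ)
  open module HomEquality {X Y : Obj} = IsEquivalence (isEquivalence {X} {Y})
    using (refl; sym; trans; reflexive)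
  open module HomMult {X Y : Obj} = CommutativeMonoidMult (Hom.+ᴹ-commutativeMonoid {X} {Y})
    using (×-congʳ; ×-congˡ; ×-assocˡ) renaming (_×_ to _·_)
  open module HomInterchange {X Y : Obj} = CommutativeSemigroupProperties
    (CommutativeMonoid.commutativeSemigroup (Hom.+ᴹ-commutativeMonoid {X} {Y})) using (interchange)
  open module HomSum {X Y : Obj} = AntidiagonalSum (Hom.+ᴹ-commutativeMonoid {X} {Y})
  open module HomReasoning {X Y : Obj} = SetoidReasoning (Hom.≈ᴹ-setoid {X} {Y})

  private
    variable
      X Y Z W : Obj

  -- Composition and natural multiples in the hom-semimodules.

  ∘-congˡ : {h : Y ⇒ Z} {f g : X ⇒ Y} → f ≈ g → h ∘ f ≈ h ∘ g
  ∘-congˡ = ∘-resp-≈ refl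

  ∘-congʳ : {h : X ⇒ Y} {f g : Y ⇒ Z} → f ≈ g → f ∘ h ≈ g ∘ h
  ∘-congʳ f≈g = ∘-resp-≈ f≈g refl

  +-∘ : (f g : Y ⇒ Z) {h : X ⇒ Y} → (f +ᴹ g) ∘ h ≈ f ∘ h +ᴹ g ∘ h
  +-∘ f g {h} = Additive.+ᴹ-homo (precomposition-additive h) f g

  0-∘ : {h : X ⇒ Y} → 0ᴹ {Y} {Z} ∘ h ≈ 0ᴹ
  0-∘ {h = h} = Additive.0ᴹ-homo (precomposition-additive h)

  ·-∘ : ∀ n {g : Y ⇒ Z} {f : X ⇒ Y} → (n · g) ∘ f ≈ n · (g ∘ f)
  ·-∘ zero    = 0-∘
  ·-∘ (suc n) = trans (+-∘ _ _) (+ᴹ-congˡ (·-∘ n))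

  ∑-∘ : ∀ k {G : ℕ → ℕ → Y ⇒ Z} {f : X ⇒ Y} → ∑ k G ∘ f ≈ ∑ k (λ i j → G i j ∘ f)
  ∑-∘ zero    = refl
  ∑-∘ (suc k) = trans (+-∘ _ _) (+ᴹ-congˡ (∑-∘ k))

  -- Taylor sequences are computed with repeated addition, whereas `ν` and the inverses of integers
  -- use the scalar action; this is the bridge.
  ·-as-*ₗ : ∀ n (f : X ⇒ Y) → n · f ≈ RawMonoidDefinitions._×_ R.+-rawMonoid n R.1# *ₗ f
  ·-as-*ₗ zero    f = sym (*ₗ-zeroˡ f)
  ·-as-*ₗ (suc n) f = begin
    f +ᴹ n · f
      ≈⟨ +ᴹ-cong (sym (*ₗ-identityˡ f)) (·-as-*ₗ n f) ⟩
    R.1# *ₗ f +ᴹ _ *ₗ f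
      ≈⟨ *ₗ-distribʳ f _ _ ⟨
    _ *ₗ f ∎

  -- Multiplication by `1/ (suc n)` undoes the factor. This is what makes a Taylor sequence depend
  -- only on its zeroth term.
  ·-cancel : ∀ n {f g : X ⇒ Y} → suc n · f ≈ suc n · g → f ≈ g
  ·-cancel n {f} {g} nf≈ng = trans (sym (divide f)) (trans (*ₗ-congˡ nf≈ng) (divide g))
    where
    divide : ∀ f → 1/ (suc n) *ₗ (suc n · f) ≈ f
    divide f = begin
      1/ (suc n) *ₗ (suc n · f) ≈⟨ *ₗ-congˡ (·-as-*ₗ (suc n) f) ⟩
      1/ (suc n) *ₗ (_ *ₗ f)    ≈⟨ *ₗ-assoc _ _ f ⟨
      (_ R.* _) *ₗ f            ≈⟨ *ₗ-congʳ (inverse (suc n)) ⟩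
      R.1# *ₗ f                 ≈⟨ *ₗ-identityˡ f ⟩
      f                         ∎

  -- Clears the denominators that `ν` introduces.
  ·-/ : ∀ i n (f : X ⇒ Y) → suc n · ((i / suc n) *ₗ f) ≈ i · f
  ·-/ i n f = begin
    suc n · ((i / suc n) *ₗ f)     ≈⟨ ·-as-*ₗ (suc n) _ ⟩
    _ *ₗ ((i / suc n) *ₗ f)        ≈⟨ *ₗ-assoc _ _ f ⟨
    (_ R.* (_ R.* 1/ (suc n))) *ₗ f
      ≈⟨ *ₗ-congʳ (R.trans (R.*-comm _ _)
                  (R.trans (R.*-assoc _ _ _)
                  (R.trans (R.*-congˡ (inverse (suc n))) (R.*-identityʳ _)))) ⟩
    _ *ₗ f                         ≈⟨ ·-as-*ₗ i f ⟨
    i · f                          ∎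

  ·-0 : ∀ n → n · 0ᴹ {X} {Y} ≈ 0ᴹ
  ·-0 zero    = refl
  ·-0 (suc n) = trans (+ᴹ-identityˡ _) (·-0 n)

  -- Linear morphisms and pairing.

  -- Preservation of `+ᴹ` and `0ᴹ` yields that of natural multiples and antidiagonal sums, the
  -- combinations later moved through such maps.
  record IsLinear (h : X ⇒ Y) : Set (o ⊔ ℓ ⊔ e) where
    field
      ∘-+      : {Z : Obj} (f g : Z ⇒ X) → h ∘ (f +ᴹ g) ≈ h ∘ f +ᴹ h ∘ g
      ∘-0      : {Z : Obj} → h ∘ 0ᴹ {Z} ≈ 0ᴹ
      D-linear′ : D h ≈ h ∘ π₁

    ∘-· : {Z : Obj} → ∀ n (f : Z ⇒ X) → h ∘ (n · f) ≈ n · (h ∘ f)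
    ∘-· zero    f = ∘-0
    ∘-· (suc n) f = trans (∘-+ f _) (+ᴹ-congˡ (∘-· n f))

    ∘-∑ : {Z : Obj} → ∀ k (G : ℕ → ℕ → Z ⇒ X) → h ∘ ∑ k G ≈ ∑ k (λ i j → h ∘ G i j)
    ∘-∑ zero    G = refl
    ∘-∑ (suc k) G = trans (∘-+ _ _) (+ᴹ-congˡ (∘-∑ k _))
  open IsLinear

  D-cong : {f g : X ⇒ Y} → f ≈ g → D f ≈ D g
  D-cong = Additive.⟦⟧-cong D-additive

  D-0 : D (0ᴹ {X} {Y}) ≈ 0ᴹ
  D-0 = Additive.0ᴹ-homo D-additive

  additive⇒linear : {h : X ⇒ Y} → IsAdditive h → D h ≈ h ∘ π₁ → IsLinear h
  additive⇒linear h-additive Dh = record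
    { ∘-+       = Additive.+ᴹ-homo h-additive
    ; ∘-0       = Additive.0ᴹ-homo h-additive
    ; D-linear′ = Dh
    }

  π-linear : ∀ n i → IsLinear (Power.π n X i)
  π-linear (fin n) i = additive⇒linear (π-additive _ i) (D-π _ i)
  π-linear {X} (ω p) i = additive⇒linear (πω-additive X i) (D-πω X i)
    where open CountablePowers (to-witness p)

  jointly-monic : ∀ n {f g : Z ⇒ T₀ n X} →
                  (∀ i → Power.π n X i ∘ f ≈ Power.π n X i ∘ g) → f ≈ g
  jointly-monic {X = X} n {f} {g} πf≈πg =
    trans (Power.unique n X _ f πf≈πg) (sym (Power.unique n X _ g (λ _ → refl)))

  ⟨⟩-unique : {f g : Z ⇒ S X} → π₀ ∘ f ≈ π₀ ∘ g → π₁ ∘ f ≈ π₁ ∘ g → f ≈ g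
  ⟨⟩-unique {f = f} {g} π₀f≈π₀g π₁f≈π₁g = jointly-monic (fin 1) πf≈πg
    where
    πf≈πg : ∀ i → Power.π (fin 1) _ i ∘ f ≈ Power.π (fin 1) _ i ∘ g
    πf≈πg fzero        = π₀f≈π₀g
    πf≈πg (fsuc fzero) = π₁f≈π₁g

  π₀-⟨⟩ : {f g : Z ⇒ X} → π₀ ∘ ⟨ f , g ⟩ ≈ f
  π₀-⟨⟩ = Product.project (finitePower 1 _) _ fzero

  π₁-⟨⟩ : {f g : Z ⇒ X} → π₁ ∘ ⟨ f , g ⟩ ≈ g
  π₁-⟨⟩ = Product.project (finitePower 1 _) _ (fsuc fzero)

  ⟨⟩-cong : {f f′ g g′ : Z ⇒ X} → f ≈ f′ → g ≈ g′ → ⟨ f , g ⟩ ≈ ⟨ f′ , g′ ⟩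
  ⟨⟩-cong f≈f′ g≈g′ = ⟨⟩-unique (trans π₀-⟨⟩ (trans f≈f′ (sym π₀-⟨⟩)))
                                (trans π₁-⟨⟩ (trans g≈g′ (sym π₁-⟨⟩)))

  π₀-⟨⟩-∘ : {f g : Z ⇒ X} {h : W ⇒ Z} → π₀ ∘ ⟨ f , g ⟩ ∘ h ≈ f ∘ h
  π₀-⟨⟩-∘ = trans (sym assoc) (∘-congʳ π₀-⟨⟩)

  π₁-⟨⟩-∘ : {f g : Z ⇒ X} {h : W ⇒ Z} → π₁ ∘ ⟨ f , g ⟩ ∘ h ≈ g ∘ h
  π₁-⟨⟩-∘ = trans (sym assoc) (∘-congʳ π₁-⟨⟩)

  ⟨⟩-∘ : {f g : Z ⇒ X} {h : W ⇒ Z} → ⟨ f , g ⟩ ∘ h ≈ ⟨ f ∘ h , g ∘ h ⟩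
  ⟨⟩-∘ = ⟨⟩-unique (trans π₀-⟨⟩-∘ (sym π₀-⟨⟩)) (trans π₁-⟨⟩-∘ (sym π₁-⟨⟩))

  0-linear : IsLinear (0ᴹ {X} {Y})
  0-linear = record
    { ∘-+       = λ _ _ → trans 0-∘ (sym (trans (+ᴹ-cong 0-∘ 0-∘) (+ᴹ-identityˡ 0ᴹ)))
    ; ∘-0       = 0-∘
    ; D-linear′ = trans D-0 (sym 0-∘)
    }

  id-linear : IsLinear (id {X})
  id-linear = record
    { ∘-+       = λ _ _ → trans identityˡ (sym (+ᴹ-cong identityˡ identityˡ))
    ; ∘-0       = identityˡ
    ; D-linear′ = trans D-id (sym identityˡ)
    }

  +-linear : {g h : X ⇒ Y} → IsLinear g → IsLinear h → IsLinear (g +ᴹ h)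
  +-linear g-linear h-linear = record
    { ∘-+ = λ _ _ → trans (+-∘ _ _) (trans (+ᴹ-cong (∘-+ g-linear _ _) (∘-+ h-linear _ _))
                    (trans (interchange _ _ _ _) (sym (+ᴹ-cong (+-∘ _ _) (+-∘ _ _)))))
    ; ∘-0 = trans (+-∘ _ _) (trans (+ᴹ-cong (∘-0 g-linear) (∘-0 h-linear)) (+ᴹ-identityˡ 0ᴹ))
    ; D-linear′ = trans (Additive.+ᴹ-homo D-additive _ _)
                  (trans (+ᴹ-cong (D-linear′ g-linear) (D-linear′ h-linear)) (sym (+-∘ _ _)))
    }

  ·-linear : ∀ n {h : X ⇒ Y} → IsLinear h → IsLinear (n · h)
  ·-linear zero    h-linear = 0-linear
  ·-linear (suc n) h-linear = +-linear h-linear (·-linear n h-linear)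

  ∑-linear : ∀ k {G : ℕ → ℕ → X ⇒ Y} → (∀ i j → IsLinear (G i j)) → IsLinear (∑ k G)
  ∑-linear zero    G-linear = G-linear 0 0
  ∑-linear (suc k) G-linear =
    +-linear (G-linear 0 (suc k)) (∑-linear k (λ i j → G-linear (suc i) j))

  D-linear-∘ : {h : Y ⇒ Z} {f : X ⇒ Y} → IsLinear h → D (h ∘ f) ≈ h ∘ D f
  D-linear-∘ {h = h} {f} h-linear = begin
    D (h ∘ f)                   ≈⟨ D-∘ f h ⟩
    D h ∘ ⟨ f ∘ π₀ , D f ⟩      ≈⟨ ∘-congʳ (D-linear′ h-linear) ⟩
    (h ∘ π₁) ∘ ⟨ f ∘ π₀ , D f ⟩ ≈⟨ assoc ⟩
    h ∘ π₁ ∘ ⟨ f ∘ π₀ , D f ⟩   ≈⟨ ∘-congˡ π₁-⟨⟩ ⟩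
    h ∘ D f                     ∎

  ∘-linear : {g : Y ⇒ Z} {f : X ⇒ Y} → IsLinear g → IsLinear f → IsLinear (g ∘ f)
  ∘-linear g-linear f-linear = record
    { ∘-+ = λ _ _ → trans assoc (trans (∘-congˡ (∘-+ f-linear _ _))
                    (trans (∘-+ g-linear _ _) (sym (+ᴹ-cong assoc assoc))))
    ; ∘-0 = trans assoc (trans (∘-congˡ (∘-0 f-linear)) (∘-0 g-linear))
    ; D-linear′ = trans (D-linear-∘ g-linear)
                        (trans (∘-congˡ (D-linear′ f-linear)) (sym assoc))
    }

  -- Projections are linear and jointly monic, so each condition can be tested after composing with
  -- them.
  jointly-linear : ∀ n {h : Z ⇒ T₀ n X} → (∀ i → IsLinear (Power.π n X i ∘ h)) → IsLinear h
  jointly-linear n πh-linear = record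
    { ∘-+ = λ f g → jointly-monic n λ i →
        trans (sym assoc) (trans (∘-+ (πh-linear i) f g)
        (trans (+ᴹ-cong assoc assoc) (sym (∘-+ (π-linear n i) _ _))))
    ; ∘-0 = jointly-monic n λ i →
        trans (sym assoc) (trans (∘-0 (πh-linear i)) (sym (∘-0 (π-linear n i))))
    ; D-linear′ = jointly-monic n λ i →
        trans (sym (D-linear-∘ (π-linear n i))) (trans (D-linear′ (πh-linear i)) assoc)
    }

  linear-resp-≈ : {f g : X ⇒ Y} → f ≈ g → IsLinear g → IsLinear f
  linear-resp-≈ f≈g g-linear = record
    { ∘-+ = λ _ _ → trans (∘-congʳ f≈g) (trans (∘-+ g-linear _ _)
                    (sym (+ᴹ-cong (∘-congʳ f≈g) (∘-congʳ f≈g))))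
    ; ∘-0 = trans (∘-congʳ f≈g) (∘-0 g-linear)
    ; D-linear′ = trans (D-cong f≈g) (trans (D-linear′ g-linear) (sym (∘-congʳ f≈g)))
    }

  -- Derivatives along vector fields.

  -- The Lie derivative of g along the vector field v.
  ∂ : Z ⇒ Z → Z ⇒ Y → Z ⇒ Y
  ∂ v g = D g ∘ ⟨ id , v ⟩

  ∂-cong : {v : Z ⇒ Z} {f g : Z ⇒ Y} → f ≈ g → ∂ v f ≈ ∂ v g
  ∂-cong f≈g = ∘-congʳ (D-cong f≈g)

  ∂-+ : (v : Z ⇒ Z) (f g : Z ⇒ Y) → ∂ v (f +ᴹ g) ≈ ∂ v f +ᴹ ∂ v g
  ∂-+ v f g = trans (∘-congʳ (Additive.+ᴹ-homo D-additive f g)) (+-∘ _ _)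

  ∂-· : ∀ n (v : Z ⇒ Z) (f : Z ⇒ Y) → ∂ v (n · f) ≈ n · ∂ v f
  ∂-· zero    v f = trans (∘-congʳ D-0) 0-∘
  ∂-· (suc n) v f = trans (∂-+ v f _) (+ᴹ-congˡ (∂-· n v f))

  ∂-∑ : ∀ k (v : Z ⇒ Z) (G : ℕ → ℕ → Z ⇒ Y) → ∂ v (∑ k G) ≈ ∑ k (λ i j → ∂ v (G i j))
  ∂-∑ zero    v G = refl
  ∂-∑ (suc k) v G = trans (∂-+ v _ _) (+ᴹ-congˡ (∂-∑ k v _))

  ∂-along-+ : (v w : Z ⇒ Z) (f : Z ⇒ Y) → ∂ (v +ᴹ w) f ≈ ∂ v f +ᴹ ∂ w f
  ∂-along-+ v w f = Additive.+ᴹ-homo (D-additive₂ f id) v w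

  ∂-along-0 : (f : Z ⇒ Y) → ∂ 0ᴹ f ≈ 0ᴹ
  ∂-along-0 f = Additive.0ᴹ-homo (D-additive₂ f id)

  ∂-∘ : (v : Z ⇒ Z) (g : X ⇒ Y) (f : Z ⇒ X) → ∂ v (g ∘ f) ≈ D g ∘ ⟨ f , ∂ v f ⟩
  ∂-∘ v g f = begin
    D (g ∘ f) ∘ ⟨ id , v ⟩                   ≈⟨ ∘-congʳ (D-∘ f g) ⟩
    (D g ∘ ⟨ f ∘ π₀ , D f ⟩) ∘ ⟨ id , v ⟩    ≈⟨ assoc ⟩
    D g ∘ ⟨ f ∘ π₀ , D f ⟩ ∘ ⟨ id , v ⟩      ≈⟨ ∘-congˡ ⟨⟩-∘ ⟩
    D g ∘ ⟨ (f ∘ π₀) ∘ ⟨ id , v ⟩ , ∂ v f ⟩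
      ≈⟨ ∘-congˡ (⟨⟩-cong (trans assoc (trans (∘-congˡ π₀-⟨⟩) identityʳ)) refl) ⟩
    D g ∘ ⟨ f , ∂ v f ⟩ ∎

  ∂-linear-∘ : {h : X ⇒ Y} → IsLinear h → (v : Z ⇒ Z) (f : Z ⇒ X) → ∂ v (h ∘ f) ≈ h ∘ ∂ v f
  ∂-linear-∘ h-linear v f = trans (∘-congʳ (D-linear-∘ h-linear)) assoc

  ∂-linear : {h : Z ⇒ Y} → IsLinear h → (v : Z ⇒ Z) → ∂ v h ≈ h ∘ v
  ∂-linear h-linear v = trans (∘-congʳ (D-linear′ h-linear)) (trans assoc (∘-congˡ π₁-⟨⟩))

  ∂-⟨⟩ : (v : Z ⇒ Z) (f g : Z ⇒ X) → ∂ v ⟨ f , g ⟩ ≈ ⟨ ∂ v f , ∂ v g ⟩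
  ∂-⟨⟩ v f g = ⟨⟩-unique (component fzero π₀-⟨⟩ π₀-⟨⟩) (component (fsuc fzero) π₁-⟨⟩ π₁-⟨⟩)
    where
    component : ∀ i {h} → Power.π (fin 1) _ i ∘ ⟨ f , g ⟩ ≈ h →
                Power.π (fin 1) _ i ∘ ⟨ ∂ v f , ∂ v g ⟩ ≈ ∂ v h →
                Power.π (fin 1) _ i ∘ ∂ v ⟨ f , g ⟩ ≈ Power.π (fin 1) _ i ∘ ⟨ ∂ v f , ∂ v g ⟩
    component i p q = trans (sym (∂-linear-∘ (π-linear (fin 1) i) v _)) (trans (∂-cong p) (sym q))

  -- `∂ w g` is the composite of `D g` with `⟨ id , w ⟩`, so the chain rule applies; the derivative
  -- of that pair along `v` is `⟨ v , ∂ v w ⟩`.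
  ∂-∂ : (v w : Z ⇒ Z) (g : Z ⇒ Y) → ∂ v (∂ w g) ≈ D (D g) ∘ ⟨ ⟨ id , w ⟩ , ⟨ v , ∂ v w ⟩ ⟩
  ∂-∂ v w g = trans (∂-∘ v (D g) ⟨ id , w ⟩) (∘-congˡ (⟨⟩-cong refl
    (trans (∂-⟨⟩ v id w) (⟨⟩-cong (trans (∂-linear id-linear v) identityˡ) refl))))

  -- The hypothesis says that the Lie bracket of the two fields vanishes. By `∂-∂` both sides are
  -- then values of `D (D g)` that differ only by exchanging the two middle entries, which
  -- `D-symmetric` allows.
  ∂-comm : (v w : Z ⇒ Z) → ∂ v w ≈ ∂ w v → (g : Z ⇒ Y) → ∂ v (∂ w g) ≈ ∂ w (∂ v g)
  ∂-comm v w ∂vw≈∂wv g = begin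
    ∂ v (∂ w g)                                   ≈⟨ ∂-∂ v w g ⟩
    D (D g) ∘ ⟨ ⟨ id , w ⟩ , ⟨ v , ∂ v w ⟩ ⟩      ≈⟨ D-symmetric g id w v (∂ v w) ⟩
    D (D g) ∘ ⟨ ⟨ id , v ⟩ , ⟨ w , ∂ v w ⟩ ⟩      ≈⟨ ∘-congˡ (⟨⟩-cong refl (⟨⟩-cong refl ∂vw≈∂wv)) ⟩
    D (D g) ∘ ⟨ ⟨ id , v ⟩ , ⟨ w , ∂ w v ⟩ ⟩      ≈⟨ ∂-∂ w v g ⟨
    ∂ w (∂ v g)                                   ∎

  -- Taylor coefficients of a morphism along a sequence.

  t-cong : ∀ k {f g : X ⇒ Y} → f ≈ g → t k f ≈ t k g
  t-cong zero    f≈g = ∘-congʳ f≈g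
  t-cong (suc k) f≈g = ∘-congʳ (D-cong (t-cong k f≈g))

  -- Opaque so that the sequence x can be inferred from initial k x.
  opaque
    initial : ∀ k → (ℕ → Z ⇒ X) → Z ⇒ Sₙ k X
    initial k x = Product.tuple (finitePower k _) (λ i → x (toℕ i))

    π-initial : ∀ k (x : ℕ → Z ⇒ X) i → Product.π (finitePower k X) i ∘ initial k x ≈ x (toℕ i)
    π-initial k x = Product.project (finitePower k _) (λ i → x (toℕ i))

  -- The argument is a whole sequence, truncated internally, so that one `x` serves all orders `k`.
  taylor : ∀ k → X ⇒ Y → (ℕ → Z ⇒ X) → Z ⇒ Y
  taylor k f x = t k f ∘ initial k x

  taylor-zero : (f : X ⇒ Y) (x : ℕ → Z ⇒ X) → taylor 0 f x ≈ f ∘ x 0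
  taylor-zero f x = trans assoc (∘-congˡ (π-initial 0 x fzero))

  taylor-congˡ : ∀ k {f g : X ⇒ Y} {x : ℕ → Z ⇒ X} → f ≈ g → taylor k f x ≈ taylor k g x
  taylor-congˡ k f≈g = ∘-congʳ (t-cong k f≈g)

  -- The bound on `i` matters later: the components of `T₁`, `ι` and `θ` are computed only at
  -- indices in range.
  taylor-congʳ : ∀ k {f : X ⇒ Y} {x y : ℕ → Z ⇒ X} → (∀ i → i ℕ.≤ k → x i ≈ y i) →
                 taylor k f x ≈ taylor k f y
  taylor-congʳ k {x = x} {y} x≈y = ∘-congˡ (jointly-monic (fin k) λ i →
    trans (π-initial k x i) (trans (x≈y (toℕ i) (ℕ.≤-pred (toℕ<n i))) (sym (π-initial k y i))))

  taylor-∘ : ∀ k {f : X ⇒ Y} {x : ℕ → Z ⇒ X} {h : W ⇒ Z} →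
             taylor k f x ∘ h ≈ taylor k f (λ i → x i ∘ h)
  taylor-∘ k {x = x} {h} = trans assoc (∘-congˡ (jointly-monic (fin k) λ i →
    trans (sym assoc) (trans (∘-congʳ (π-initial k x i)) (sym (π-initial k _ i)))))

  -- Taylor sequences and their uniqueness.

  -- The sequence x k = vᵏ(x 0) / k! of Taylor coefficients along the flow of v.
  IsTaylor : Z ⇒ Z → (ℕ → Z ⇒ X) → Set e
  IsTaylor v x = ∀ k → ∂ v (x k) ≈ suc k · x (suc k)

  -- The derivative of each term is a positive multiple of the next, and `·-cancel` divides. Later
  -- identities between Taylor coefficients are reduced by this to their zeroth terms.
  IsTaylor-unique : {v : Z ⇒ Z} {x y : ℕ → Z ⇒ X} → IsTaylor v x → IsTaylor v y →
                    x 0 ≈ y 0 → ∀ k → x k ≈ y k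
  IsTaylor-unique ∂x ∂y x₀≈y₀ zero    = x₀≈y₀
  IsTaylor-unique ∂x ∂y x₀≈y₀ (suc k) =
    ·-cancel k (trans (sym (∂x k)) (trans (∂-cong (IsTaylor-unique ∂x ∂y x₀≈y₀ k)) (∂y k)))

  IsTaylor-resp-≈ : {v : Z ⇒ Z} {x y : ℕ → Z ⇒ X} → (∀ k → x k ≈ y k) →
                    IsTaylor v y → IsTaylor v x
  IsTaylor-resp-≈ x≈y ∂y k =
    trans (∂-cong (x≈y k)) (trans (∂y k) (×-congʳ (suc k) (sym (x≈y (suc k)))))

  IsTaylor-linear : {v : Z ⇒ Z} {x : ℕ → Z ⇒ X} {h : X ⇒ Y} → IsLinear h →
                    IsTaylor v x → IsTaylor v (λ k → h ∘ x k)
  IsTaylor-linear {v = v} {x} h-linear ∂x k =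
    trans (∂-linear-∘ h-linear v (x k)) (trans (∘-congˡ (∂x k)) (∘-· h-linear (suc k) (x (suc k))))

  -- By the chain rule the derivative is `D (t k f)` at the point `x≤k` in the direction `∂ v x≤k`.
  -- The map `ν` sends `x≤k+1` to that point together with the direction divided by `k + 1`, and
  -- additivity of `D (t k f)` in the direction releases the factor.
  IsTaylor-taylor : {v : Z ⇒ Z} {x : ℕ → Z ⇒ X} (f : X ⇒ Y) → IsTaylor v x →
                    IsTaylor v (λ k → taylor k f x)
  IsTaylor-taylor {Z = Z} {X = X} {v = v} {x} f ∂x k = begin
    ∂ v (t k f ∘ x≤k)                          ≈⟨ ∂-∘ v (t k f) x≤k ⟩
    D (t k f) ∘ ⟨ x≤k , ∂ v x≤k ⟩              ≈⟨ ∘-congˡ (⟨⟩-cong refl ∂x≤k) ⟩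
    D (t k f) ∘ ⟨ x≤k , suc k · (ν₁ ∘ x≤k+1) ⟩ ≈⟨ additive₂ (suc k) ⟩
    suc k · (D (t k f) ∘ ⟨ x≤k , ν₁ ∘ x≤k+1 ⟩)
      ≈⟨ ×-congʳ (suc k) (∘-congˡ (trans ⟨⟩-∘ (⟨⟩-cong ν₀-initial refl))) ⟨
    suc k · (D (t k f) ∘ ν k X ∘ x≤k+1)        ≈⟨ ×-congʳ (suc k) assoc ⟨
    suc k · ((D (t k f) ∘ ν k X) ∘ x≤k+1)      ∎
    where
    open Product (finitePower k X) using (tuple; project)
    open Product (finitePower (suc k) X) using (π)

    x≤k : Z ⇒ Sₙ k X
    x≤k = initial k x

    x≤k+1 : Z ⇒ Sₙ (suc k) X
    x≤k+1 = initial (suc k) x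

    ν₀ ν₁ : Sₙ (suc k) X ⇒ Sₙ k X
    ν₀ = tuple (λ i → π (inject₁ i))
    ν₁ = tuple (λ i → (suc (toℕ i) / suc k) *ₗ π (fsuc i))

    additive₂ : ∀ n {u} → D (t k f) ∘ ⟨ x≤k , n · u ⟩ ≈ n · (D (t k f) ∘ ⟨ x≤k , u ⟩)
    additive₂ zero    = Additive.0ᴹ-homo (D-additive₂ (t k f) x≤k)
    additive₂ (suc n) =
      trans (Additive.+ᴹ-homo (D-additive₂ (t k f) x≤k) _ _) (+ᴹ-congˡ (additive₂ n))

    ν₀-initial : ν₀ ∘ x≤k+1 ≈ x≤k
    ν₀-initial = jointly-monic (fin k) λ i →
      trans (sym assoc) (trans (∘-congʳ (project _ i)) (trans (π-initial (suc k) x (inject₁ i))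
      (trans (reflexive (≡.cong x (toℕ-inject₁ i))) (sym (π-initial k x i)))))

    ∂x≤k : ∂ v x≤k ≈ suc k · (ν₁ ∘ x≤k+1)
    ∂x≤k = jointly-monic (fin k) λ i → begin
      Product.π (finitePower k X) i ∘ ∂ v x≤k
        ≈⟨ ∂-linear-∘ (π-linear (fin k) i) v x≤k ⟨
      ∂ v (Product.π (finitePower k X) i ∘ x≤k)
        ≈⟨ ∂-cong (π-initial k x i) ⟩
      ∂ v (x (toℕ i))
        ≈⟨ ∂x (toℕ i) ⟩
      suc (toℕ i) · x (suc (toℕ i))
        -- This is where the coefficients of `ν` come from: its entry `i` has to be `(i + 1) xᵢ₊₁`
        -- divided by `k + 1`.
        ≈⟨ ·-/ (suc (toℕ i)) k _ ⟨
      suc k · ((suc (toℕ i) / suc k) *ₗ x (suc (toℕ i)))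
        ≈⟨ ×-congʳ (suc k) (*ₗ-congˡ (π-initial (suc k) x (fsuc i))) ⟨
      suc k · ((suc (toℕ i) / suc k) *ₗ (π (fsuc i) ∘ x≤k+1))
        ≈⟨ ×-congʳ (suc k) (Additive.*ₗ-homo (precomposition-additive x≤k+1) _ _) ⟨
      suc k · (((suc (toℕ i) / suc k) *ₗ π (fsuc i)) ∘ x≤k+1)
        ≈⟨ ×-congʳ (suc k) (trans (sym assoc) (∘-congʳ (project _ i))) ⟨
      suc k · (Product.π (finitePower k X) i ∘ ν₁ ∘ x≤k+1)
        ≈⟨ ∘-· (π-linear (fin k) i) (suc k) _ ⟨
      Product.π (finitePower k X) i ∘ (suc k · (ν₁ ∘ x≤k+1))
        ∎

  -- Both sides are Taylor sequences in `k` for the same field and start with `h ∘ x 0`.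
  taylor-linear : ∀ k {h : X ⇒ Y} {v : Z ⇒ Z} {x : ℕ → Z ⇒ X} → IsLinear h → IsTaylor v x →
                  taylor k h x ≈ h ∘ x k
  taylor-linear k {h} {x = x} h-linear ∂x =
    IsTaylor-unique (IsTaylor-taylor h ∂x) (IsTaylor-linear h-linear ∂x) (taylor-zero h x) k

  -- The higher chain rule without Faà di Bruno combinatorics: both sides are Taylor sequences that
  -- start with `g ∘ f ∘ x 0`.
  taylor-comp : ∀ k (g : Y ⇒ W) (f : X ⇒ Y) {v : Z ⇒ Z} {x : ℕ → Z ⇒ X} → IsTaylor v x →
                taylor k (g ∘ f) x ≈ taylor k g (λ i → taylor i f x)
  taylor-comp k g f {x = x} ∂x = IsTaylor-unique
    (IsTaylor-taylor (g ∘ f) ∂x) (IsTaylor-taylor g (IsTaylor-taylor f ∂x))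
    (trans (taylor-zero (g ∘ f) x) (trans assoc
      (sym (trans (taylor-zero g _) (∘-congˡ (taylor-zero f x)))))) k

  taylor-linear-comp : ∀ k {h : Y ⇒ W} (f : X ⇒ Y) {v : Z ⇒ Z} {x : ℕ → Z ⇒ X} → IsLinear h →
                       IsTaylor v x → taylor k (h ∘ f) x ≈ h ∘ taylor k f x
  taylor-linear-comp k {h} f h-linear ∂x =
    trans (taylor-comp k h f ∂x) (taylor-linear k h-linear (IsTaylor-taylor f ∂x))

  -- Families of coefficients for two vector fields.

  ·-comm : ∀ m n (f : X ⇒ Y) → m · (n · f) ≈ n · (m · f)
  ·-comm m n f = trans (×-assocˡ f m n) (trans (×-congˡ (ℕ.*-comm m n)) (sym (×-assocˡ f n m)))

  -- Induction on `j`: up to the factor `j + 1`, the entry `G i (suc j)` is the derivative of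
  -- `G i j` along `w`, and `∂ v` passes through `∂ w`. The factor is cancelled at the end.
  IsTaylor-commuting : {v w : Z ⇒ Z} → ∂ v w ≈ ∂ w v → {G : ℕ → ℕ → Z ⇒ X} →
                       (∀ i → IsTaylor w (G i)) → IsTaylor v (λ i → G i 0) →
                       ∀ j → IsTaylor v (λ i → G i j)
  IsTaylor-commuting ∂vw≈∂wv ∂wG ∂vG₀ zero    = ∂vG₀
  IsTaylor-commuting {v = v} {w} ∂vw≈∂wv {G} ∂wG ∂vG₀ (suc j) i = ·-cancel j (begin
    suc j · ∂ v (G i (suc j))               ≈⟨ ∂-· (suc j) v _ ⟨
    ∂ v (suc j · G i (suc j))               ≈⟨ ∂-cong (∂wG i j) ⟨
    ∂ v (∂ w (G i j))                       ≈⟨ ∂-comm v w ∂vw≈∂wv _ ⟩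
    ∂ w (∂ v (G i j))                       ≈⟨ ∂-cong (IsTaylor-commuting ∂vw≈∂wv ∂wG ∂vG₀ j i) ⟩
    ∂ w (suc i · G (suc i) j)               ≈⟨ ∂-· (suc i) w _ ⟩
    suc i · ∂ w (G (suc i) j)               ≈⟨ ×-congʳ (suc i) (∂wG (suc i) j) ⟩
    suc i · (suc j · G (suc i) (suc j))     ≈⟨ ·-comm (suc i) (suc j) _ ⟩
    suc j · (suc i · G (suc i) (suc j))     ∎)

  -- Derivation along a sum of fields splits, and `∑-leibniz` collects the two parts. This is the
  -- exponential law for flows, read coefficientwise.
  IsTaylor-∑ : {v w : Z ⇒ Z} {G : ℕ → ℕ → Z ⇒ X} →
               (∀ j → IsTaylor v (λ i → G i j)) → (∀ i → IsTaylor w (G i)) →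
               IsTaylor (v +ᴹ w) (λ k → ∑ k G)
  IsTaylor-∑ {v = v} {w} {G} ∂vG ∂wG k = begin
    ∂ (v +ᴹ w) (∑ k G)                      ≈⟨ ∂-∑ k (v +ᴹ w) G ⟩
    ∑ k (λ i j → ∂ (v +ᴹ w) (G i j))
      ≈⟨ ∑-cong k (λ i j _ → trans (∂-along-+ v w (G i j)) (+ᴹ-cong (∂vG j i) (∂wG i j))) ⟩
    ∑ k (λ i j → suc i · G (suc i) j +ᴹ suc j · G i (suc j))
      ≈⟨ ∑-leibniz k G ⟩
    suc k · ∑ (suc k) G                     ∎

  -- Zero-extended projections and the components of the structure maps.

  -- The projection onto the component k, extended by 0 beyond the order n: then (p n) is a Taylor
  -- sequence without any condition on k.
  p : (n : Order P) → ℕ → T₀ n X ⇒ X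
  p {X} (fin n)      = extend (Power.π (fin n) X) 0ᴹ
  p {X} (ω ω-powers) = Power.π (ω ω-powers) X

  p-value : ∀ n i → p {X} n (value n i) ≡ Power.π n X i
  p-value (fin n) i = extend-toℕ _ _ i
  p-value (ω _)   i = ≡.refl

  -- Amounts to `k ≤ n` for finite `n` and always holds for `ω`; phrased through `value` so that
  -- both kinds of order are handled alike.
  InRange : Order P → ℕ → Set
  InRange n k = ∃ λ i → value n i ≡ k

  inRange-≤ : ∀ n {j k} → InRange n k → j ℕ.≤ k → InRange n j
  inRange-≤ n (i , ≡.refl) j≤i =
    include n i (fromℕ< (s≤s j≤i)) , ≡.trans (value-include n i _) (toℕ-fromℕ< (s≤s j≤i))

  inRange-∑ˡ : ∀ n {i j k} → InRange n k → i ℕ.+ j ≡ k → InRange n i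
  inRange-∑ˡ n {i} {j} k∈n ≡.refl = inRange-≤ n k∈n (ℕ.m≤m+n i j)

  inRange-∑ʳ : ∀ n {i j k} → InRange n k → i ℕ.+ j ≡ k → InRange n j
  inRange-∑ʳ n {i} {j} k∈n ≡.refl = inRange-≤ n k∈n (ℕ.m≤n+m j i)

  -- The negative case covers all `l ≥ k` because `p-shift` needs both `k` and `k + 1`, and
  -- quantifies over the object because `p-T₁-linear` needs both source and target.
  inRange? : ∀ n k → InRange n k ⊎ (∀ {X} l → k ℕ.≤ l → p {X} n l ≡ 0ᴹ)
  inRange? (fin n) k with k ℕ.<? suc n
  ... | yes k<1+n = inj₁ (fromℕ< k<1+n , toℕ-fromℕ< k<1+n)
  ... | no  k≮1+n = inj₂ (λ l k≤l → extend-≥ _ _ (ℕ.≤-trans (ℕ.≮⇒≥ k≮1+n) k≤l))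
  inRange? (ω _)   k = inj₁ (k , ≡.refl)

  p-monic : ∀ n {f g : Z ⇒ T₀ n X} → (∀ k → InRange n k → p n k ∘ f ≈ p n k ∘ g) → f ≈ g
  p-monic n pf≈pg = jointly-monic n λ i →
    ≡.subst (λ q → q ∘ _ ≈ q ∘ _) (p-value n i) (pf≈pg (value n i) (i , ≡.refl))

  p-linear : ∀ n k → IsLinear (p {X} n k)
  p-linear n k with inRange? n k
  ... | inj₁ (i , ≡.refl) = ≡.subst IsLinear (≡.sym (p-value n i)) (π-linear n i)
  ... | inj₂ p≡0          = ≡.subst IsLinear (≡.sym (p≡0 k ℕ.≤-refl)) 0-linear

  p-tuple : ∀ n (x : ℕ → Z ⇒ X) {k} → InRange n k →
            p n k ∘ Power.tuple n X (λ i → x (value n i)) ≈ x k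
  p-tuple n x (i , ≡.refl) =
    ≡.subst (λ q → q ∘ _ ≈ x _) (≡.sym (p-value n i)) (Power.project n _ (λ i → x (value n i)) i)

  -- Formal differentiation, with `p n k` as the coefficient of degree `k`; for a finite order the
  -- padding of `p` supplies 0 in the top degree.
  shift : ∀ n X → T₀ n X ⇒ T₀ n X
  shift n X = Power.tuple n X (λ i → suc (value n i) · p n (suc (value n i)))

  p-shift : ∀ n k → p n k ∘ shift n X ≈ suc k · p n (suc k)
  p-shift {X} n k with inRange? n k
  ... | inj₁ k∈n = p-tuple n (λ k → suc k · p n (suc k)) k∈n
  ... | inj₂ p≡0 = begin
    p n k ∘ shift n X      ≈⟨ ∘-congʳ (reflexive (p≡0 k ℕ.≤-refl)) ⟩
    0ᴹ ∘ shift n X         ≈⟨ 0-∘ ⟩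
    0ᴹ                     ≈⟨ ·-0 (suc k) ⟨
    suc k · 0ᴹ             ≈⟨ ×-congʳ (suc k) (reflexive (p≡0 (suc k) (ℕ.n≤1+n k))) ⟨
    suc k · p n (suc k)    ∎

  IsTaylor-p : ∀ n → IsTaylor (shift n X) (p n)
  IsTaylor-p n k = trans (∂-linear (p-linear n k) _) (p-shift n k)

  -- The components of `restrict` are the initial projections, so `T₁` becomes an instance of
  -- `taylor` at the sequence `p n`, where uniqueness of Taylor sequences applies.
  p-T₁ : ∀ n (f : X ⇒ Y) {k} → InRange n k → p n k ∘ T₁ n f ≈ taylor k f (p n)
  p-T₁ {X} {Y} n f {k} k∈n = trans (∘-congˡ T₁≈) (p-tuple n (λ k → taylor k f (p n)) k∈n)
    where
    T₁≈ : T₁ n f ≈ Power.tuple n Y (λ i → taylor (value n i) f (p n))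
    T₁≈ = Power.unique n Y _ _ λ i → trans (Power.project n Y _ i)
      (∘-congˡ (jointly-monic (fin (value n i)) λ j → trans (Product.project (finitePower _ X) _ j)
        (trans (reflexive (≡.trans (≡.sym (p-value n (include n i j))) (≡.cong (p n) (value-include n i j))))
               (sym (π-initial (value n i) (p n) j)))))

  -- In range this is `taylor-linear` for the sequence `p n`; out of range both sides are 0.
  -- Allowing every `k` keeps the sequences below infinite.
  p-T₁-linear : ∀ n {h : X ⇒ Y} → IsLinear h → ∀ k → p n k ∘ T₁ n h ≈ h ∘ p n k
  p-T₁-linear n {h} h-linear k with inRange? n k
  ... | inj₁ k∈n = trans (p-T₁ n h k∈n) (taylor-linear k h-linear (IsTaylor-p n))
  ... | inj₂ p≡0 = begin
    p n k ∘ T₁ n h  ≈⟨ ∘-congʳ (reflexive (p≡0 k ℕ.≤-refl)) ⟩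
    0ᴹ ∘ T₁ n h     ≈⟨ 0-∘ ⟩
    0ᴹ              ≈⟨ ∘-0 h-linear ⟨
    h ∘ 0ᴹ          ≈⟨ ∘-congˡ (reflexive (p≡0 k ℕ.≤-refl)) ⟨
    h ∘ p n k       ∎

  p-ι : ∀ n {k} → InRange n k → p n k ∘ ι n X ≈ δ k X
  p-ι n = p-tuple n (λ k → δ k _)

  p-θ : ∀ n {k} → InRange n k → p n k ∘ θ n X ≈ ∑ k (λ i j → p n i ∘ p n j)
  p-θ {X} n k∈n = trans (∘-congˡ θ≈) (p-tuple n (λ k → ∑ k (λ i j → p n i ∘ p n j)) k∈n)
    where
    π≈p : ∀ {Y} i j → Power.π n Y (include n i j) ≈ p n (toℕ j)
    π≈p i j = reflexive (≡.trans (≡.sym (p-value n _)) (≡.cong (p n) (value-include n i j)))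

    θ≈ : θ n X ≈ Power.tuple n X (λ i → ∑ (value n i) (λ i j → p n i ∘ p n j))
    θ≈ = Power.unique n X _ _ λ i → trans (Power.project n X _ i)
      (trans (sum-cong (suc (value n i)) (λ j → ∘-resp-≈ (π≈p i j) (π≈p i (opposite j))))
             (sum≈∑ (value n i) (λ i j → p n i ∘ p n j)))

  p-c : ∀ n m {i j} → InRange n i → InRange m j → p n i ∘ p m j ∘ c n m X ≈ p m j ∘ p n i
  p-c {X} n m {i} {j} i∈n (l , ≡.refl) = begin
    p n i ∘ p m (value m l) ∘ c n m X
      ≈⟨ ∘-congˡ (∘-congʳ (reflexive (p-value m l))) ⟩
    p n i ∘ Power.π m _ l ∘ c n m X
      ≈⟨ ∘-congˡ (trans (Power.project m _ _ l) (Power.unique n X _ _ λ k →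
           trans (Power.project n X _ k)
                 (sym (∘-resp-≈ (reflexive (p-value m l)) (reflexive (p-value n k)))))) ⟩
    p n i ∘ Power.tuple n X (λ k → p m (value m l) ∘ p n (value n k))
      ≈⟨ p-tuple n (λ k → p m (value m l) ∘ p n k) i∈n ⟩
    p m (value m l) ∘ p n i
      ∎

  -- Linearity of the structure maps.

  p-linear⇒linear : ∀ n {h : Z ⇒ T₀ n X} → (∀ k → InRange n k → IsLinear (p n k ∘ h)) → IsLinear h
  p-linear⇒linear n {h} ph-linear = jointly-linear n λ i →
    linear-resp-≈ (∘-congʳ (reflexive (≡.sym (p-value n i)))) (ph-linear (value n i) (i , ≡.refl))

  δ-linear : ∀ k → IsLinear (δ k X)
  δ-linear zero    = id-linear
  δ-linear (suc _) = 0-linear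

  ι-linear : ∀ n → IsLinear (ι n X)
  ι-linear n = p-linear⇒linear n λ k k∈n → linear-resp-≈ (p-ι n k∈n) (δ-linear k)

  θ-linear : ∀ n → IsLinear (θ n X)
  θ-linear n = p-linear⇒linear n λ k k∈n → linear-resp-≈ (p-θ n k∈n)
    (∑-linear k (λ i j → ∘-linear (p-linear n i) (p-linear n j)))

  c-linear : ∀ n m → IsLinear (c n m X)
  c-linear n m = p-linear⇒linear m λ j j∈m → p-linear⇒linear n λ i i∈n →
    linear-resp-≈ (p-c n m i∈n j∈m) (∘-linear (p-linear m j) (p-linear n i))

  shift-linear : ∀ n → IsLinear (shift n X)
  shift-linear n = p-linear⇒linear n λ k _ →
    linear-resp-≈ (p-shift n k) (·-linear (suc k) (p-linear n (suc k)))

  -- Mixed Taylor coefficients on an iterated power.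

  module _ (n m : Order P) (X : Obj) where
    -- With `p m j ∘ p n i` as the coefficients of a series in two variables, these are its partial
    -- derivatives; `innerShift` acts inside each component because `shift m X` is linear.
    outerShift innerShift : T₀ n (T₀ m X) ⇒ T₀ n (T₀ m X)
    outerShift = shift n (T₀ m X)
    innerShift = T₁ n (shift m X)

    ∂-innerShift-p : ∀ i → ∂ innerShift (p n i) ≈ shift m X ∘ p n i
    ∂-innerShift-p i = trans (∂-linear (p-linear n i) _) (p-T₁-linear n (shift-linear m) i)

    -- The outer shift changes the position and the inner one the value found there: in component
    -- `k` both sides are `suc k` times `shift m X ∘ p n (suc k)`.
    shifts-commute : ∂ outerShift innerShift ≈ ∂ innerShift outerShift
    shifts-commute = p-monic n λ k _ → begin
      p n k ∘ ∂ outerShift innerShift       ≈⟨ ∂-linear-∘ (p-linear n k) _ _ ⟨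
      ∂ outerShift (p n k ∘ innerShift)     ≈⟨ ∂-cong (p-T₁-linear n (shift-linear m) k) ⟩
      ∂ outerShift (shift m X ∘ p n k)      ≈⟨ ∂-linear-∘ (shift-linear m) _ _ ⟩
      shift m X ∘ ∂ outerShift (p n k)      ≈⟨ ∘-congˡ (IsTaylor-p n k) ⟩
      shift m X ∘ (suc k · p n (suc k))     ≈⟨ ∘-· (shift-linear m) (suc k) _ ⟩
      suc k · (shift m X ∘ p n (suc k))     ≈⟨ ×-congʳ (suc k) (∂-innerShift-p (suc k)) ⟨
      suc k · ∂ innerShift (p n (suc k))    ≈⟨ ∂-· (suc k) _ _ ⟨
      ∂ innerShift (suc k · p n (suc k))    ≈⟨ ∂-cong (p-shift n k) ⟨
      ∂ innerShift (p n k ∘ outerShift)     ≈⟨ ∂-linear-∘ (p-linear n k) _ _ ⟩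
      p n k ∘ ∂ innerShift outerShift       ∎

    IsTaylor-outer : ∀ j → IsTaylor outerShift (λ i → p m j ∘ p n i)
    IsTaylor-outer j = IsTaylor-linear (p-linear m j) (IsTaylor-p n)

    IsTaylor-inner : ∀ i → IsTaylor innerShift (λ j → p m j ∘ p n i)
    IsTaylor-inner i j = begin
      ∂ innerShift (p m j ∘ p n i)      ≈⟨ ∂-linear-∘ (p-linear m j) _ _ ⟩
      p m j ∘ ∂ innerShift (p n i)      ≈⟨ ∘-congˡ (∂-innerShift-p i) ⟩
      p m j ∘ shift m X ∘ p n i         ≈⟨ assoc ⟨
      (p m j ∘ shift m X) ∘ p n i       ≈⟨ ∘-congʳ (p-shift m j) ⟩
      (suc j · p m (suc j)) ∘ p n i     ≈⟨ ·-∘ (suc j) ⟩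
      suc j · (p m (suc j) ∘ p n i)     ∎

    module _ (f : X ⇒ Y) where
      -- The mixed coefficient, expanded in either order. The first is visibly a Taylor sequence in
      -- `i` and the second in `j`; their equality is the symmetry of mixed derivatives.
      doubleTaylor doubleTaylor′ : ℕ → ℕ → T₀ n (T₀ m X) ⇒ Y
      doubleTaylor  i j = taylor i (taylor j f (p m)) (p n)
      doubleTaylor′ i j = taylor j (taylor i f (p n)) (λ j → T₁ n (p m j))

      p-p-T₁-T₁ : ∀ {i j} → InRange n i → InRange m j →
                  p m j ∘ p n i ∘ T₁ n (T₁ m f) ≈ doubleTaylor i j
      p-p-T₁-T₁ {i} {j} i∈n j∈m = begin
        p m j ∘ p n i ∘ T₁ n (T₁ m f)       ≈⟨ ∘-congˡ (p-T₁ n (T₁ m f) i∈n) ⟩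
        p m j ∘ taylor i (T₁ m f) (p n)     ≈⟨ taylor-linear-comp i (T₁ m f) (p-linear m j) (IsTaylor-p n) ⟨
        taylor i (p m j ∘ T₁ m f) (p n)     ≈⟨ taylor-congˡ i (p-T₁ m f j∈m) ⟩
        doubleTaylor i j                    ∎

      p-T₁-p : ∀ i j → p n i ∘ T₁ n (p {X} m j) ≈ p m j ∘ p n i
      p-T₁-p i j = p-T₁-linear n (p-linear m j) i

      -- Assembles the sequences of `IsTaylor-inner` over all components, as required to expand
      -- along `T₁ n (p m j)` in `doubleTaylor′`.
      IsTaylor-T₁-p : IsTaylor innerShift (λ j → T₁ n (p m j))
      IsTaylor-T₁-p j = p-monic n λ i _ → begin
        p n i ∘ ∂ innerShift (T₁ n (p m j))     ≈⟨ ∂-linear-∘ (p-linear n i) _ _ ⟨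
        ∂ innerShift (p n i ∘ T₁ n (p m j))     ≈⟨ ∂-cong (p-T₁-p i j) ⟩
        ∂ innerShift (p m j ∘ p n i)            ≈⟨ IsTaylor-inner i j ⟩
        suc j · (p m (suc j) ∘ p n i)           ≈⟨ ×-congʳ (suc j) (p-T₁-p i (suc j)) ⟨
        suc j · (p n i ∘ T₁ n (p m (suc j)))    ≈⟨ ∘-· (p-linear n i) (suc j) _ ⟨
        p n i ∘ (suc j · T₁ n (p m (suc j)))    ∎

      doubleTaylor′-zero : ∀ i → doubleTaylor′ i 0 ≈ taylor i f (λ i → p m 0 ∘ p n i)
      doubleTaylor′-zero i = trans (taylor-zero _ _)
        (trans (taylor-∘ i) (taylor-congʳ i (λ l _ → p-T₁-p l 0)))

      doubleTaylor-zero : ∀ j → doubleTaylor 0 j ≈ taylor j f (λ j → p m j ∘ p n 0)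
      doubleTaylor-zero j = trans (taylor-zero _ _) (taylor-∘ j)

      doubleTaylor′-inner : ∀ i → IsTaylor innerShift (doubleTaylor′ i)
      doubleTaylor′-inner i = IsTaylor-taylor (taylor i f (p n)) IsTaylor-T₁-p

      -- For `j = 0` these are Taylor coefficients of `f` along an outer Taylor sequence; as the
      -- shifts commute, the property spreads to every `j`.
      doubleTaylor′-outer : ∀ j → IsTaylor outerShift (λ i → doubleTaylor′ i j)
      doubleTaylor′-outer = IsTaylor-commuting shifts-commute doubleTaylor′-inner
        (IsTaylor-resp-≈ doubleTaylor′-zero (IsTaylor-taylor f (IsTaylor-outer 0)))

      doubleTaylor-outer : ∀ j → IsTaylor outerShift (λ i → doubleTaylor i j)
      doubleTaylor-outer j = IsTaylor-taylor (taylor j f (p m)) (IsTaylor-p n)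

      -- Uniqueness along the outer shift reduces to `i = 0`, and there uniqueness along the inner
      -- shift reduces to `j = 0`, where both sides are `f ∘ p m 0 ∘ p n 0`.
      doubleTaylor-symmetric : ∀ i j → doubleTaylor i j ≈ doubleTaylor′ i j
      doubleTaylor-symmetric i j =
        IsTaylor-unique (doubleTaylor-outer j) (doubleTaylor′-outer j) (i≡0 j) i
        where
        i≡0 : ∀ j → doubleTaylor 0 j ≈ doubleTaylor′ 0 j
        i≡0 = IsTaylor-unique
          (IsTaylor-resp-≈ doubleTaylor-zero (IsTaylor-taylor f (IsTaylor-inner 0)))
          (doubleTaylor′-inner 0)
          (trans (doubleTaylor-zero 0)
            (trans (taylor-zero f _) (sym (trans (doubleTaylor′-zero 0) (taylor-zero f _)))))

      doubleTaylor-inner : ∀ i → IsTaylor innerShift (doubleTaylor i)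
      doubleTaylor-inner i = IsTaylor-resp-≈ (doubleTaylor-symmetric i) (doubleTaylor′-inner i)

  -- Functoriality and the monad laws.

  taylor-identity : ∀ n k → taylor k (id {X}) (p n) ≈ p n k
  taylor-identity n k = trans (taylor-linear k id-linear (IsTaylor-p n)) identityˡ

  -- Along the zero vector field all derivatives vanish, so any sequence that is 0 from index 1 on
  -- is a Taylor sequence; both sides then start with `f`.
  taylor-constant : ∀ k (f : X ⇒ Y) → taylor k f (λ k → δ k X) ≈ δ k Y ∘ f
  taylor-constant {X} {Y} k f = IsTaylor-unique (IsTaylor-taylor f δ-taylor) δf-taylor
    (trans (taylor-zero f _) (trans identityʳ (sym identityˡ))) k
    where
    δ-taylor : IsTaylor 0ᴹ (λ k → δ k X)
    δ-taylor k = trans (∂-along-0 _) (sym (·-0 (suc k)))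

    δf-taylor : IsTaylor 0ᴹ (λ k → δ k Y ∘ f)
    δf-taylor k = trans (∂-along-0 _) (sym (trans (×-congʳ (suc k) 0-∘) (·-0 (suc k))))

  T-isEndofunctor : ∀ n → IsEndofunctor category (T₀ n) (T₁ n)
  T-isEndofunctor n = record
    { F-resp-≈ = λ {_} {_} {f} {g} f≈g → p-monic n λ k k∈n →
        trans (p-T₁ n f k∈n) (trans (taylor-congˡ k f≈g) (sym (p-T₁ n g k∈n)))
    ; identity = p-monic n λ k k∈n →
        trans (p-T₁ n id k∈n) (trans (taylor-identity n k) (sym identityʳ))
    ; homomorphism = λ {_} {_} {_} {f} {g} → p-monic n λ k k∈n → begin
        p n k ∘ T₁ n (g ∘ f)                   ≈⟨ p-T₁ n (g ∘ f) k∈n ⟩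
        taylor k (g ∘ f) (p n)                 ≈⟨ taylor-comp k g f (IsTaylor-p n) ⟩
        taylor k g (λ i → taylor i f (p n))    ≈⟨ taylor-congʳ k (λ i i≤k → p-T₁ n f (inRange-≤ n k∈n i≤k)) ⟨
        taylor k g (λ i → p n i ∘ T₁ n f)      ≈⟨ taylor-∘ k ⟨
        taylor k g (p n) ∘ T₁ n f              ≈⟨ ∘-congʳ (p-T₁ n g k∈n) ⟨
        (p n k ∘ T₁ n g) ∘ T₁ n f              ≈⟨ assoc ⟩
        p n k ∘ T₁ n g ∘ T₁ n f                ∎
    }

  p-θ-∘ : ∀ n {k} → InRange n k → (h : Z ⇒ T₀ n (T₀ n X)) →
          p n k ∘ θ n X ∘ h ≈ ∑ k (λ i j → p n i ∘ p n j ∘ h)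
  p-θ-∘ n {k} k∈n h = trans (sym assoc) (trans (∘-congʳ (p-θ n k∈n))
    (trans (∑-∘ k) (∑-cong k (λ _ _ _ → assoc))))

  T-isMonad : ∀ n → IsMonad category (T n)
  T-isMonad n = record
    { isEndofunctor = T-isEndofunctor n
    ; η-natural = λ {X} {Y} f → p-monic n λ k k∈n → begin
        p n k ∘ ι n Y ∘ f                 ≈⟨ assoc ⟨
        (p n k ∘ ι n Y) ∘ f               ≈⟨ ∘-congʳ (p-ι n k∈n) ⟩
        δ k Y ∘ f                         ≈⟨ taylor-constant k f ⟨
        taylor k f (λ k → δ k X)          ≈⟨ taylor-congʳ k (λ i i≤k → p-ι n (inRange-≤ n k∈n i≤k)) ⟨
        taylor k f (λ k → p n k ∘ ι n X)  ≈⟨ taylor-∘ k ⟨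
        taylor k f (p n) ∘ ι n X          ≈⟨ ∘-congʳ (p-T₁ n f k∈n) ⟨
        (p n k ∘ T₁ n f) ∘ ι n X          ≈⟨ assoc ⟩
        p n k ∘ T₁ n f ∘ ι n X            ∎
    ; μ-natural = λ {X} {Y} f → p-monic n λ k k∈n → begin
        p n k ∘ θ n Y ∘ T₁ n (T₁ n f)
          ≈⟨ p-θ-∘ n k∈n _ ⟩
        ∑ k (λ i j → p n i ∘ p n j ∘ T₁ n (T₁ n f))
          ≈⟨ ∑-cong k (λ i j i+j≡k →
               p-p-T₁-T₁ n n X f (inRange-∑ʳ n k∈n i+j≡k) (inRange-∑ˡ n k∈n i+j≡k)) ⟩
        ∑ k (λ i j → doubleTaylor n n X f j i)
          -- Both sides are Taylor sequences for the inner plus the outer shift. The indices of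
          -- `doubleTaylor` appear swapped because in `p n i ∘ p n j` the outer index is `j`.
          ≈⟨ IsTaylor-unique
               (IsTaylor-∑ (doubleTaylor-inner n n X f) (doubleTaylor-outer n n X f))
               (IsTaylor-taylor f (IsTaylor-∑ (IsTaylor-inner n n X) (IsTaylor-outer n n X)))
               (trans (doubleTaylor-zero n n X f 0) (trans (taylor-zero f _) (sym (taylor-zero f _)))) k ⟩
        taylor k f (λ k → ∑ k (λ i j → p n i ∘ p n j))
          ≈⟨ taylor-congʳ k (λ i i≤k → p-θ n (inRange-≤ n k∈n i≤k)) ⟨
        taylor k f (λ k → p n k ∘ θ n X)
          ≈⟨ taylor-∘ k ⟨
        taylor k f (p n) ∘ θ n X
          ≈⟨ ∘-congʳ (p-T₁ n f k∈n) ⟨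
        (p n k ∘ T₁ n f) ∘ θ n X
          ≈⟨ assoc ⟩
        p n k ∘ T₁ n f ∘ θ n X
          ∎
    ; μ-assoc = λ X → p-monic n λ k k∈n → begin
        p n k ∘ θ n X ∘ T₁ n (θ n X)
          ≈⟨ p-θ-∘ n k∈n _ ⟩
        ∑ k (λ i j → p n i ∘ p n j ∘ T₁ n (θ n X))
          -- Linearity of `θ` lets `T₁ n` apply it in each component, so both sides become triple
          -- sums.
          ≈⟨ ∑-cong k (λ i j i+j≡k → trans (∘-congˡ (p-T₁-linear n (θ-linear n) j))
               (p-θ-∘ n (inRange-∑ˡ n k∈n i+j≡k) _)) ⟩
        ∑ k (λ i j → ∑ i (λ a b → p n a ∘ p n b ∘ p n j))
          ≈⟨ ∑-assoc k (λ a b j → p n a ∘ p n b ∘ p n j) ⟩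
        ∑ k (λ i j → ∑ j (λ a b → p n i ∘ p n a ∘ p n b))
          ≈⟨ ∑-cong k (λ i j i+j≡k → trans (∘-congˡ (p-θ n (inRange-∑ʳ n k∈n i+j≡k)))
               (∘-∑ (p-linear n i) j _)) ⟨
        ∑ k (λ i j → p n i ∘ p n j ∘ θ n (T₀ n X))
          ≈⟨ p-θ-∘ n k∈n _ ⟨
        p n k ∘ θ n X ∘ θ n (T₀ n X)
          ∎
    ; μ-identityˡ = λ X → p-monic n λ k k∈n → begin
        p n k ∘ θ n X ∘ T₁ n (ι n X)
          ≈⟨ p-θ-∘ n k∈n _ ⟩
        ∑ k (λ i j → p n i ∘ p n j ∘ T₁ n (ι n X))
          ≈⟨ ∑-cong k (λ i j i+j≡k → trans (∘-congˡ (p-T₁-linear n (ι-linear n) j))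
               (trans (sym assoc) (∘-congʳ (p-ι n (inRange-∑ˡ n k∈n i+j≡k))))) ⟩
        ∑ k (λ i j → δ i X ∘ p n j)
          ≈⟨ ∑-only-first k _ (λ _ _ → 0-∘) ⟩
        id ∘ p n k
          ≈⟨ trans identityˡ (sym identityʳ) ⟩
        p n k ∘ id
          ∎
    ; μ-identityʳ = λ X → p-monic n λ k k∈n → begin
        p n k ∘ θ n X ∘ ι n (T₀ n X)
          ≈⟨ p-θ-∘ n k∈n _ ⟩
        ∑ k (λ i j → p n i ∘ p n j ∘ ι n (T₀ n X))
          ≈⟨ ∑-cong k (λ i j i+j≡k → ∘-congˡ (p-ι n (inRange-∑ʳ n k∈n i+j≡k))) ⟩
        ∑ k (λ i j → p n i ∘ δ j (T₀ n X))
          ≈⟨ ∑-only-last k _ (λ i _ → ∘-0 (p-linear n i)) ⟩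
        p n k ∘ id
          ∎
    }

  -- The distributive law.

  p-c-∘ : ∀ n m {i j} → InRange n i → InRange m j → (h : Z ⇒ T₀ n (T₀ m X)) →
          p n i ∘ p m j ∘ c n m X ∘ h ≈ p m j ∘ p n i ∘ h
  p-c-∘ n m i∈n j∈m h = trans (∘-congˡ (sym assoc)) (trans (sym assoc)
    (trans (∘-congʳ (p-c n m i∈n j∈m)) assoc))

  p-T₁-linear-∘ : ∀ n {h : X ⇒ Y} → IsLinear h → ∀ k (g : Z ⇒ T₀ n X) →
                  p n k ∘ T₁ n h ∘ g ≈ h ∘ p n k ∘ g
  p-T₁-linear-∘ n h-linear k g =
    trans (sym assoc) (trans (∘-congʳ (p-T₁-linear n h-linear k)) assoc)

  c-isDistributiveLaw : ∀ n m → IsDistributiveLaw category (T n) (T m) (c n m)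
  c-isDistributiveLaw n m = record
    { natural = λ {X} {Y} f → p-monic m λ j j∈m → p-monic n λ i i∈n → begin
        p n i ∘ p m j ∘ c n m Y ∘ T₁ n (T₁ m f)
          ≈⟨ p-c-∘ n m i∈n j∈m _ ⟩
        p m j ∘ p n i ∘ T₁ n (T₁ m f)
          ≈⟨ p-p-T₁-T₁ n m X f i∈n j∈m ⟩
        doubleTaylor n m X f i j
          ≈⟨ doubleTaylor-symmetric n m X f i j ⟩
        taylor j (taylor i f (p n)) (λ j → T₁ n (p m j))
          -- In range, `p m b ∘ c n m X` is `T₁ n (p m b)`, since both have components
          -- `p m b ∘ p n a`. Hence the second expansion is the mixed coefficient for the exchanged
          -- orders, pulled back along `c`.
          ≈⟨ taylor-congʳ j (λ b b≤j → p-monic n λ a a∈n →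
               trans (p-c n m a∈n (inRange-≤ m j∈m b≤j)) (sym (p-T₁-linear n (p-linear m b) a))) ⟨
        taylor j (taylor i f (p n)) (λ j → p m j ∘ c n m X)
          ≈⟨ taylor-∘ j ⟨
        doubleTaylor m n X f j i ∘ c n m X
          ≈⟨ ∘-congʳ (p-p-T₁-T₁ m n X f j∈m i∈n) ⟨
        (p n i ∘ p m j ∘ T₁ m (T₁ n f)) ∘ c n m X
          ≈⟨ trans assoc (∘-congˡ assoc) ⟩
        p n i ∘ p m j ∘ T₁ m (T₁ n f) ∘ c n m X
          ∎
    ; unitˢ = λ X → p-monic m λ j j∈m → p-monic n λ i i∈n → begin
        p n i ∘ p m j ∘ c n m X ∘ ι n (T₀ m X)  ≈⟨ p-c-∘ n m i∈n j∈m _ ⟩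
        p m j ∘ p n i ∘ ι n (T₀ m X)            ≈⟨ ∘-congˡ (p-ι n i∈n) ⟩
        p m j ∘ δ i (T₀ m X)                    ≈⟨ ∘-δ i (p-linear m j) ⟩
        δ i X ∘ p m j                           ≈⟨ ∘-congʳ (p-ι n i∈n) ⟨
        (p n i ∘ ι n X) ∘ p m j                 ≈⟨ assoc ⟩
        p n i ∘ ι n X ∘ p m j                   ≈⟨ ∘-congˡ (p-T₁-linear m (ι-linear n) j) ⟨
        p n i ∘ p m j ∘ T₁ m (ι n X)            ∎
    ; unitᵗ = λ X → p-monic m λ j j∈m → p-monic n λ i i∈n → begin
        p n i ∘ p m j ∘ c n m X ∘ T₁ n (ι m X)  ≈⟨ p-c-∘ n m i∈n j∈m _ ⟩
        p m j ∘ p n i ∘ T₁ n (ι m X)            ≈⟨ ∘-congˡ (p-T₁-linear n (ι-linear m) i) ⟩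
        p m j ∘ ι m X ∘ p n i                   ≈⟨ assoc ⟨
        (p m j ∘ ι m X) ∘ p n i                 ≈⟨ ∘-congʳ (p-ι m j∈m) ⟩
        δ j X ∘ p n i                           ≈⟨ ∘-δ j (p-linear n i) ⟨
        p n i ∘ δ j (T₀ n X)                    ≈⟨ ∘-congˡ (p-ι m j∈m) ⟨
        p n i ∘ p m j ∘ ι m (T₀ n X)            ∎
    ; multˢ = λ X → p-monic m λ j j∈m → p-monic n λ i i∈n → begin
        p n i ∘ p m j ∘ c n m X ∘ θ n (T₀ m X)
          ≈⟨ p-c-∘ n m i∈n j∈m _ ⟩
        p m j ∘ p n i ∘ θ n (T₀ m X)
          ≈⟨ ∘-congˡ (p-θ n i∈n) ⟩
        p m j ∘ ∑ i (λ a b → p n a ∘ p n b)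
          ≈⟨ ∘-∑ (p-linear m j) i _ ⟩
        ∑ i (λ a b → p m j ∘ p n a ∘ p n b)
          -- `p m j` passes `p n b` by the outer `c`, then `p n a` by the inner one, which `T₁ n`
          -- applies componentwise because `c` is linear.
          ≈⟨ ∑-cong i (λ a b a+b≡i → begin
               p n a ∘ p n b ∘ p m j ∘ c n m (T₀ n X) ∘ T₁ n (c n m X)
                 ≈⟨ ∘-congˡ (p-c-∘ n m (inRange-∑ʳ n i∈n a+b≡i) j∈m _) ⟩
               p n a ∘ p m j ∘ p n b ∘ T₁ n (c n m X)
                 ≈⟨ ∘-congˡ (∘-congˡ (p-T₁-linear n (c-linear n m) b)) ⟩
               p n a ∘ p m j ∘ c n m X ∘ p n b
                 ≈⟨ p-c-∘ n m (inRange-∑ˡ n i∈n a+b≡i) j∈m _ ⟩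
               p m j ∘ p n a ∘ p n b
                 ∎) ⟨
        ∑ i (λ a b → p n a ∘ p n b ∘ p m j ∘ c n m (T₀ n X) ∘ T₁ n (c n m X))
          ≈⟨ p-θ-∘ n i∈n _ ⟨
        p n i ∘ θ n X ∘ p m j ∘ c n m (T₀ n X) ∘ T₁ n (c n m X)
          ≈⟨ ∘-congˡ (p-T₁-linear-∘ m (θ-linear n) j _) ⟨
        p n i ∘ p m j ∘ T₁ m (θ n X) ∘ c n m (T₀ n X) ∘ T₁ n (c n m X)
          ∎
    ; multᵗ = λ X → p-monic m λ j j∈m → p-monic n λ i i∈n → begin
        p n i ∘ p m j ∘ c n m X ∘ T₁ n (θ m X)
          ≈⟨ p-c-∘ n m i∈n j∈m _ ⟩
        p m j ∘ p n i ∘ T₁ n (θ m X)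
          ≈⟨ ∘-congˡ (p-T₁-linear n (θ-linear m) i) ⟩
        p m j ∘ θ m X ∘ p n i
          ≈⟨ p-θ-∘ m j∈m _ ⟩
        ∑ j (λ a b → p m a ∘ p m b ∘ p n i)
          -- Mirror image: `p n i` passes `p m a` by the `c` that `T₁ m` applies componentwise, then
          -- `p m b` by the other one.
          ≈⟨ ∑-cong j (λ a b a+b≡j → begin
               p n i ∘ p m a ∘ p m b ∘ T₁ m (c n m X) ∘ c n m (T₀ m X)
                 ≈⟨ ∘-congˡ (∘-congˡ (p-T₁-linear-∘ m (c-linear n m) b _)) ⟩
               p n i ∘ p m a ∘ c n m X ∘ p m b ∘ c n m (T₀ m X)
                 ≈⟨ p-c-∘ n m i∈n (inRange-∑ˡ m j∈m a+b≡j) _ ⟩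
               p m a ∘ p n i ∘ p m b ∘ c n m (T₀ m X)
                 ≈⟨ ∘-congˡ (p-c n m i∈n (inRange-∑ʳ m j∈m a+b≡j)) ⟩
               p m a ∘ p m b ∘ p n i
                 ∎) ⟨
        ∑ j (λ a b → p n i ∘ p m a ∘ p m b ∘ T₁ m (c n m X) ∘ c n m (T₀ m X))
          ≈⟨ ∘-∑ (p-linear n i) j _ ⟨
        p n i ∘ ∑ j (λ a b → p m a ∘ p m b ∘ T₁ m (c n m X) ∘ c n m (T₀ m X))
          ≈⟨ ∘-congˡ (p-θ-∘ m j∈m _) ⟨
        p n i ∘ p m j ∘ θ m (T₀ n X) ∘ T₁ m (c n m X) ∘ c n m (T₀ m X)
          ∎
    }
    where
    ∘-δ : ∀ k {h : X ⇒ Y} → IsLinear h → h ∘ δ k X ≈ δ k Y ∘ h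
    ∘-δ zero    h-linear = trans identityʳ (sym identityˡ)
    ∘-δ (suc k) h-linear = trans (∘-0 h-linear) (sym 0-∘)

corollary2 : ∀ {r ℓr o ℓ e}
             (R : CommutativeSemiring r ℓr) (inverses : PositiveIntegerInverses R)
             (C : CartesianDifferentialCategory R o ℓ e) (P : Maybe (CountablePowers C)) →
             let open CartesianDifferentialCategory C using (category)
                 open Taylor inverses C P
             in (n m : Order P) →
                IsMonad category (T n) × IsDistributiveLaw category (T n) (T m) (c n m)
corollary2 R inverses C P n m = T-isMonad inverses C P n , c-isDistributiveLaw inverses C P n m
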